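{- For all POCKA-terms $e,f\in\mathcal T$, if $e\equiv f$ then $(\!|e|\!){\downarrow}=(\!|f|\!){\downarrow}$.
   Context: **States and observations.** Let $\mathrm{Var}$ and $\mathrm{Val}$ be finite sets (variables and values). $\mathsf{State}$ is the set of partial functions $\alpha:\mathrm{Var}\rightharpoonup\mathrm{Val}$, with domain $\mathrm{dom}(\alpha)$, ordered by $\alpha\le\beta$ iff $\mathrm{dom}(\beta)\subseteq\mathrm{dom}(\alpha)$ and $\alpha(x)=\beta(x)$ for all $x\in\mathrm{dom}(\beta)$. $\mathsf{Act}$ is the set of formal symbols $(v\leftarrow n)$ and $(v\leftarrow v')$, and $\mathsf{Obs}$ the set of formal symbols $(v=n)$, for $v,v'\in\mathrm{Var}$, $n\in\mathrm{Val}$. Observation terms $\mathcal O$ are generated by $p,q::=\bot\mid\top\mid o\in\mathsf{Obs}\mid p\vee q\mid p\wedge q\mid\overline p$. Let $P_\le(\mathsf{State})$ be the set of downwards-closed subsets of $\mathsf{State}$; the map $[\![-]\!]_{\mathrm{OA}}:\mathcal O\to P_\le(\mathsf{State})$ is the homomorphism with $[\![\bot]\!]=\emptyset$, $[\![\top]\!]=\mathsf{State}$, $[\![v=n]\!]=\{\alpha:\alpha(v)=n\}$, $\vee\mapsto\cup$, $\wedge\mapsto\cap$, and $[\![\overline p]\!]=\bigcup\{Z\in P_\le(\mathsf{State}): [\![p]\!]\cap Z=\emptyset\}$. **Congruence $\equiv_{\mathrm{OA}}$.** The smallest congruence on $\mathcal O$ (for $\vee,\wedge,\overline{\,\cdot\,}$)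 satisfying, where $p\leqq q$ means $p\vee q\equiv q$: the bounded distributive lattice axioms ($\vee,\wedge$ associative, commutative, absorptive, mutually distributive, $p\vee\bot\equiv p\equiv p\wedge\top$); $p\leqq\overline q\Leftrightarrow p\wedge q\equiv\bot$; $(v=n)\wedge(v=m)\equiv\bot$ for $n\ne m$; $\overline{v=n}\leqq\bigvee_{m\neq n}(v=m)$; $\overline{\bigwedge_i (v_i=n_i)}\leqq\bigvee_i\overline{v_i=n_i}$ for finite families with pairwise distinct $v_i$. Empty joins are $\bot$, empty meets $\top$. **Terms.** For an alphabet $\Sigma$, $\mathcal E_\Sigma$ is generated by $e,f::=0\mid1\mid a\in\Sigma\mid e+f\mid e\cdot f\mid e\parallel f\mid e^*$. POCKA-terms are $\mathcal T=\mathcal E_{\mathsf{Act}\cup\mathcal O}$ (each $p\in\mathcal O$ is a letter). **Congruence $\equiv$ on $\mathcal T$.** The smallest congruence on $\mathcal T$, writing $e\leqq f$ for $e+f\equiv f$, such that: $p\equiv q$ whenever $p\equiv_{\mathrm{OA}}q$; Kleene algebra axioms: $+$ is associative, commutative, idempotent with unit $0$; $\cdot$ is associative with unit $1$, annihilator $0$ on both sides, and distributes over $+$ on both sides; $e^*\equiv1+e\cdot e^*\equiv 1+e^*\cdot e$; $e+f\cdot g\leqq f\Rightarrow e\cdot g^*\leqq f$; $e+f\cdot g\leqq g\Rightarrow f^*\cdot e\leqq g$; $\parallel$ is associative, commutative, with unit $1$, annihilator $0$, and distributes over $+$; exchange law $(e\parallel f)\cdot(g\parallel h)\leqq(e\cdot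 g)\parallel(f\cdot h)$; interface axioms, for $p,q\in\mathcal O$ and $a\in\mathsf{Act}$: $p\wedge q\leqq p\cdot q$, $p\vee q\equiv p+q$, $0\equiv\bot$, $\top\cdot p\leqq p$, $p\cdot\top\leqq p$, $\top\cdot a\leqq a$, $a\cdot\top\leqq a$. **Pomsets.** A pomset over $\Sigma$ is an isomorphism class of finite $\Sigma$-labelled posets $\mathbf u=\langle S_{\mathbf u},\le_{\mathbf u},\lambda_{\mathbf u}\rangle$; $1$ is the empty pomset, and a letter $a$ denotes the one-node pomset labelled $a$. $U\parallel V$ is the disjoint union; $U\cdot V$ is the disjoint union with additionally every node of $U$ below every node of $V$. $\mathsf{SP}(\Sigma)$ is the smallest set of pomsets containing $1$ and all letters and closed under $\cdot$ and $\parallel$. Operations lift pointwise to languages; $L^*=\bigcup_n L^n$. BKA-semantics $[\![-]\!]_{\mathrm{BKA}}:\mathcal E_\Sigma\to2^{\mathsf{SP}(\Sigma)}$: $0\mapsto\emptyset$, $1\mapsto\{1\}$, $a\mapsto\{a\}$, $+\mapsto\cup$, and $\cdot,\parallel,{}^*$ to the language operations. **Closure.** A pomset context $C\in\mathsf{PC}(\Sigma)$ is a series-parallel pomset over $\Sigma\cup\{*\}$ with exactly one node labelled $*$; $C[U]$ is obtained by substituting $U$ for that node, and $C[L]=\{C[U]:U\in L\}$. For a set $H$ of hypotheses (formal inequations $e\le f$ with $e,f\in\mathcal E_\Sigma$), $L{\downarrow^H}$ is the smallest language containing $L$ such that whenever $e\le f\in H$, $C\in\mathsf{PC}(\Sigma)$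 and $C[[\![f]\!]_{\mathrm{BKA}}]\subseteq L{\downarrow^H}$, also $C[[\![e]\!]_{\mathrm{BKA}}]\subseteq L{\downarrow^H}$. **POCKA-semantics.** Take $\Sigma=\mathsf{Act}\cup\mathsf{State}$. Define $(\!|-|\!):\mathcal T\to2^{\mathsf{SP}(\Sigma)}$ by $(\!|a|\!)=\mathsf{State}^*\cdot\{a\}\cdot\mathsf{State}^*$ for $a\in\mathsf{Act}$, $(\!|p|\!)=\mathsf{State}^*\cdot[\![p]\!]_{\mathrm{OA}}\cdot\mathsf{State}^*$ for $p\in\mathcal O$, $(\!|0|\!)=\emptyset$, $(\!|1|\!)=\{1\}$, $(\!|e+f|\!)=(\!|e|\!)\cup(\!|f|\!)$, $(\!|e\cdot f|\!)=(\!|e|\!)\cdot(\!|f|\!)$, $(\!|e\parallel f|\!)=(\!|e|\!)\parallel(\!|f|\!)$, $(\!|e^*|\!)=(\!|e|\!)^*$. Let $\mathsf{exch}=\{(e\parallel f)\cdot(g\parallel h)\le(e\cdot g)\parallel(f\cdot h): e,f,g,h\in\mathcal E_\Sigma\}$ and $\mathsf{contr}=\{\alpha\le\alpha\cdot\alpha:\alpha\in\mathsf{State}\}$. Then $(\!|e|\!){\downarrow}=(\!|e|\!){\downarrow^{\mathsf{exch}\cup\mathsf{contr}}}$. -}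

module Defs where

open import Data.Fin.Base using (Fin; zero; suc)
open import Data.Fin.Properties using (0↔⊥; 1↔⊤; +↔⊎; inj⇒≟)
open import Data.List.Base using (List; map; filter; foldr; tabulate; allFin)
open import Data.Maybe.Base using (Maybe; just; nothing)
import Data.Maybe.Relation.Binary.Pointwise as MaybePW
open import Data.Nat.Base using (ℕ; zero; suc; _+_)
open import Data.Product using (Σ; ∃; ∃-syntax; ∃!; _×_; _,_)
open import Data.Product.Function.Dependent.Propositional using (Σ-↔)
open import Data.Sum.Base using (_⊎_; inj₁; inj₂; [_,_]′)
open import Data.Sum.Function.Propositional using (_⊎-↔_)
open import Data.Sum.Relation.Binary.LeftOrder using (_⊎-<_; ⊎-<-isPartialOrder)
open import Data.Sum.Relation.Binary.Pointwise
  using (Pointwise; Pointwise-≡⇒≡; ≡⇒Pointwise-≡; ⊎-setoid; ⊎-isPartialOrder)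
open import Data.Unit.Base using (⊤; tt)
open import Data.Empty using (⊥; ⊥-elim)
open import Function.Base using (_∘_)
open import Function.Bundles using (_↔_; _⇔_; mk↔ₛ′; module Inverse)
open import Function.Definitions using (Injective)
open import Function.Properties.Inverse using (↔-refl; ↔-sym; ↔-trans; ↔⇒↣)
open import Level using (0ℓ; Lift) renaming (suc to lsuc)
open import Relation.Binary.Bundles using (Setoid)
open import Relation.Binary.Core using (Rel)
open import Relation.Binary.Construct.Union using () renaming (_∪_ to _∪ʰ_)
open import Relation.Binary.Definitions using (DecidableEquality)
open import Relation.Binary.PropositionalEquality
  using (_≡_; _≢_; refl; cong; isEquivalence; setoid; _→-setoid_)
open import Relation.Binary.Structures using (IsPartialOrder)
open import Relation.Nullary.Decidable using (¬?)
open import Relation.Unary using (Pred; Empty; _∈_; _⊆_; _∩_; _∪_; ⋃)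
open import Relation.Unary.Polymorphic using (∅; U)

------------------------------------------------------------------------
-- Finite sets

Finite : Set → Set
Finite A = ∃ λ n → A ↔ Fin n

module _ {A : Set} where

  finite⇒≟ : Finite A → DecidableEquality A
  finite⇒≟ (_ , A↔Fin) = inj⇒≟ (↔⇒↣ A↔Fin)

  enumerate : Finite A → List A
  enumerate (n , A↔Fin) = map (Inverse.from A↔Fin) (allFin n)

⊥-finite : Finite ⊥
⊥-finite = 0 , ↔-sym 0↔⊥

⊤-finite : Finite ⊤
⊤-finite = 1 , ↔-sym 1↔⊤

⊎-finite : {A B : Set} → Finite A → Finite B → Finite (A ⊎ B)
⊎-finite (m , f) (n , g) = m + n , ↔-trans (f ⊎-↔ g) (↔-sym +↔⊎)

private
  Σ-suc : ∀ {n} {B : Fin (suc n) → Set} →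
          Σ (Fin (suc n)) B ↔ (B zero ⊎ Σ (Fin n) (B ∘ suc))
  Σ-suc = mk↔ₛ′
    (λ { (zero , b) → inj₁ b ; (suc i , b) → inj₂ (i , b) })
    (λ { (inj₁ b) → zero , b ; (inj₂ (i , b)) → suc i , b })
    (λ { (inj₁ _) → refl ; (inj₂ _) → refl })
    (λ { (zero , _) → refl ; (suc _ , _) → refl })

  Σ-Fin-finite : ∀ n {B : Fin n → Set} → (∀ i → Finite (B i)) → Finite (Σ (Fin n) B)
  Σ-Fin-finite zero    fin = 0 , mk↔ₛ′ (λ { (() , _) }) (λ ()) (λ ()) (λ { (() , _) })
  Σ-Fin-finite (suc n) fin
    with k , f ← ⊎-finite (fin zero) (Σ-Fin-finite n (fin ∘ suc)) =
    k , ↔-trans Σ-suc f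

Σ-finite : {A : Set} {B : A → Set} → Finite A → (∀ x → Finite (B x)) → Finite (Σ A B)
Σ-finite {B = B} (n , f) fin
  with k , g ← Σ-Fin-finite n (λ i → fin (Inverse.from f i)) =
  k , ↔-trans (↔-sym (Σ-↔ (↔-sym f) ↔-refl)) g

------------------------------------------------------------------------
-- Pomsets

-- Alphabets are setoids, because letters may be partial functions, which are
-- compared pointwise.
Alphabet : Set₁
Alphabet = Setoid 0ℓ 0ℓ

-- A representative of a pomset; equality of pomsets is _≅_ below.
record Pomset (S : Alphabet) : Set₁ where
  field
    Node           : Set
    finite         : Finite Node
    _≼_            : Rel Node 0ℓ
    isPartialOrder : IsPartialOrder _≡_ _≼_
    label          : Node → Setoid.Carrier S

record _≅_ {S : Alphabet} (V W : Pomset S) : Set where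
  private
    module V = Pomset V
    module W = Pomset W
  field
    nodes  : V.Node ↔ W.Node
    orders : ∀ x y → (x V.≼ y) ⇔ (Inverse.to nodes x W.≼ Inverse.to nodes y)
    labels : ∀ x → Setoid._≈_ S (V.label x) (W.label (Inverse.to nodes x))

infix 4 _≅_

private
  ⊎-≡ : {A B : Set} {_≤_ : Rel (A ⊎ B) 0ℓ} →
        IsPartialOrder (Pointwise _≡_ _≡_) _≤_ → IsPartialOrder _≡_ _≤_
  ⊎-≡ po = record
    { isPreorder = record
      { isEquivalence = isEquivalence
      ; reflexive     = P.reflexive ∘ ≡⇒Pointwise-≡
      ; trans         = P.trans
      }
    ; antisym = λ p q → Pointwise-≡⇒≡ (P.antisym p q)
    }
    where module P = IsPartialOrder po

module _ {S : Alphabet} where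

  private
    Letter = Setoid.Carrier S

  1ᴾ : Pomset S
  1ᴾ = record
    { Node           = ⊥
    ; finite         = ⊥-finite
    ; _≼_            = λ ()
    ; isPartialOrder = record
      { isPreorder = record
        { isEquivalence = isEquivalence
        ; reflexive     = λ { {()} }
        ; trans         = λ { {()} }
        }
      ; antisym = λ { {()} }
      }
    ; label          = λ ()
    }

  ⟨_⟩ : Letter → Pomset S
  ⟨ a ⟩ = record
    { Node           = ⊤
    ; finite         = ⊤-finite
    ; _≼_            = λ _ _ → ⊤
    ; isPartialOrder = record
      { isPreorder = record
        { isEquivalence = isEquivalence
        ; reflexive     = λ _ → tt
        ; trans         = λ _ _ → tt
        }
      ; antisym = λ _ _ → refl
      }
    ; label          = λ _ → a
    }

  infixl 7 _·ᴾ_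
  infixl 6 _∥ᴾ_

  _·ᴾ_ : Pomset S → Pomset S → Pomset S
  V ·ᴾ W = record
    { Node           = V.Node ⊎ W.Node
    ; finite         = ⊎-finite V.finite W.finite
    ; _≼_            = V._≼_ ⊎-< W._≼_
    ; isPartialOrder = ⊎-≡ (⊎-<-isPartialOrder V.isPartialOrder W.isPartialOrder)
    ; label          = [ V.label , W.label ]′
    }
    where
    module V = Pomset V
    module W = Pomset W

  _∥ᴾ_ : Pomset S → Pomset S → Pomset S
  V ∥ᴾ W = record
    { Node           = V.Node ⊎ W.Node
    ; finite         = ⊎-finite V.finite W.finite
    ; _≼_            = Pointwise V._≼_ W._≼_
    ; isPartialOrder = ⊎-≡ (⊎-isPartialOrder V.isPartialOrder W.isPartialOrder)
    ; label          = [ V.label , W.label ]′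
    }
    where
    module V = Pomset V
    module W = Pomset W

data SP {S : Alphabet} : Pred (Pomset S) (lsuc 0ℓ) where
  one    : SP 1ᴾ
  letter : ∀ a → SP ⟨ a ⟩
  seq    : ∀ {V W} → SP V → SP W → SP (V ·ᴾ W)
  par    : ∀ {V W} → SP V → SP W → SP (V ∥ᴾ W)
  iso    : ∀ {V W} → V ≅ W → SP V → SP W

------------------------------------------------------------------------
-- Pomset contexts

-- The extra letter * is `nothing`.
_∪* : Alphabet → Alphabet
S ∪* = MaybePW.setoid S

record PC (S : Alphabet) : Set₁ where
  field
    pomset : Pomset (S ∪*)
    isSP   : SP pomset
    hole   : ∃! _≡_ (λ x → Pomset.label pomset x ≡ nothing)

-- Every node x of C is replaced by the pomset `block x`: a node labelled *
-- by V, any other node by the one-node pomset carrying the same label.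
module Substitution {S : Alphabet} (C : Pomset (S ∪*)) (V : Pomset S) where

  private
    module C = Pomset C

  plug : Maybe (Setoid.Carrier S) → Pomset S
  plug nothing  = V
  plug (just a) = ⟨ a ⟩

  block : C.Node → Pomset S
  block x = plug (C.label x)

  SNode : Set
  SNode = Σ C.Node (Pomset.Node ∘ block)

  data _⊑_ : Rel SNode 0ℓ where
    outer : ∀ {x y i j} → x C.≼ y → x ≢ y → (x , i) ⊑ (y , j)
    inner : ∀ {x i j} → Pomset._≼_ (block x) i j → (x , i) ⊑ (x , j)

  private
    ⊑-reflexive : ∀ {s t} → s ≡ t → s ⊑ t
    ⊑-reflexive {x , _} refl = inner (IsPartialOrder.refl (Pomset.isPartialOrder (block x)))

    ⊑-trans : ∀ {s t u} → s ⊑ t → t ⊑ u → s ⊑ u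
    ⊑-trans (outer p x≢y) (outer q _) =
      outer (IsPartialOrder.trans C.isPartialOrder p q)
            (λ { refl → x≢y (IsPartialOrder.antisym C.isPartialOrder p q) })
    ⊑-trans (outer p x≢y) (inner _)   = outer p x≢y
    ⊑-trans (inner _)     (outer q n) = outer q n
    ⊑-trans (inner {x} p) (inner q)   =
      inner (IsPartialOrder.trans (Pomset.isPartialOrder (block x)) p q)

    ⊑-antisym : ∀ {s t} → s ⊑ t → t ⊑ s → s ≡ t
    ⊑-antisym (outer p x≢y) (outer q _) =
      ⊥-elim (x≢y (IsPartialOrder.antisym C.isPartialOrder p q))
    ⊑-antisym (outer _ x≢x) (inner _)   = ⊥-elim (x≢x refl)
    ⊑-antisym (inner _)     (outer _ n) = ⊥-elim (n refl)
    ⊑-antisym (inner {x} p) (inner q)   =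
      cong (x ,_) (IsPartialOrder.antisym (Pomset.isPartialOrder (block x)) p q)

  substitute : Pomset S
  substitute = record
    { Node           = SNode
    ; finite         = Σ-finite C.finite (Pomset.finite ∘ block)
    ; _≼_            = _⊑_
    ; isPartialOrder = record
      { isPreorder = record
        { isEquivalence = isEquivalence
        ; reflexive     = ⊑-reflexive
        ; trans         = ⊑-trans
        }
      ; antisym = ⊑-antisym
      }
    ; label          = λ (x , i) → Pomset.label (block x) i
    }

infix 8 _[_]

_[_] : {S : Alphabet} → PC S → Pomset S → Pomset S
C [ V ] = Substitution.substitute (PC.pomset C) V

------------------------------------------------------------------------
-- Pomset languages

-- A language is a predicate on representatives.  The languages built from the
-- operations below contain series-parallel pomsets only, and singletons,
-- products and contexts are closed under _≅_, so that they are sets of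
-- pomsets rather than of representatives.
Language : Alphabet → Set₂
Language S = Pred (Pomset S) (lsuc 0ℓ)

module _ {S : Alphabet} where

  infixl 7 _·ᴸ_
  infixl 6 _∥ᴸ_
  infix  9 _^ᴸ_ _*ᴸ
  infix  8 _[_]ᴸ

  ｛_｝ : Pomset S → Language S
  ｛ V ｝ W = Lift _ (W ≅ V)

  _·ᴸ_ : Language S → Language S → Language S
  (L ·ᴸ K) X = ∃[ V ] ∃[ W ] (V ∈ L × W ∈ K × X ≅ V ·ᴾ W)

  _∥ᴸ_ : Language S → Language S → Language S
  (L ∥ᴸ K) X = ∃[ V ] ∃[ W ] (V ∈ L × W ∈ K × X ≅ V ∥ᴾ W)

  _^ᴸ_ : Language S → ℕ → Language S
  L ^ᴸ zero  = ｛ 1ᴾ ｝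
  L ^ᴸ suc n = L ·ᴸ L ^ᴸ n

  _*ᴸ : Language S → Language S
  L *ᴸ = ⋃ ℕ (L ^ᴸ_)

  _[_]ᴸ : PC S → Language S → Language S
  (C [ L ]ᴸ) X = ∃[ V ] (V ∈ L × X ≅ C [ V ])

------------------------------------------------------------------------
-- Terms, BKA-semantics and closure

infixl 6 _⊹_
infixl 7 _∥_
infixl 8 _·_
infix  9 _⋆

data Term (A : Set) : Set where
  𝟘 𝟙         : Term A
  letter      : A → Term A
  _⊹_ _·_ _∥_ : Term A → Term A → Term A
  _⋆          : Term A → Term A

module _ {S : Alphabet} where

  private
    ℰ = Term (Setoid.Carrier S)

  ⟦_⟧ᴮᴷᴬ : ℰ → Language S
  ⟦ 𝟘 ⟧ᴮᴷᴬ        = ∅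
  ⟦ 𝟙 ⟧ᴮᴷᴬ        = ｛ 1ᴾ ｝
  ⟦ letter a ⟧ᴮᴷᴬ = ｛ ⟨ a ⟩ ｝
  ⟦ e ⊹ f ⟧ᴮᴷᴬ    = ⟦ e ⟧ᴮᴷᴬ ∪ ⟦ f ⟧ᴮᴷᴬ
  ⟦ e · f ⟧ᴮᴷᴬ    = ⟦ e ⟧ᴮᴷᴬ ·ᴸ ⟦ f ⟧ᴮᴷᴬ
  ⟦ e ∥ f ⟧ᴮᴷᴬ    = ⟦ e ⟧ᴮᴷᴬ ∥ᴸ ⟦ f ⟧ᴮᴷᴬ
  ⟦ e ⋆ ⟧ᴮᴷᴬ      = ⟦ e ⟧ᴮᴷᴬ *ᴸ

  infix 9 _↓[_]

  -- `H e f` means that the inequation e ≤ f is a hypothesis.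
  data _↓[_] (L : Language S) (H : Rel ℰ 0ℓ) : Language S where
    incl : L ⊆ L ↓[ H ]
    hyp  : ∀ {e f} → H e f → (C : PC S) →
           C [ ⟦ f ⟧ᴮᴷᴬ ]ᴸ ⊆ L ↓[ H ] →
           C [ ⟦ e ⟧ᴮᴷᴬ ]ᴸ ⊆ L ↓[ H ]

------------------------------------------------------------------------
-- POCKA

module POCKA (Var Val : Set) (finVar : Finite Var) (finVal : Finite Val) where

  State : Set
  State = Var → Maybe Val

  dom : State → Pred Var 0ℓ
  dom α x = ∃[ n ] α x ≡ just n

  infix 4 _≤ˢ_

  _≤ˢ_ : Rel State 0ℓ
  α ≤ˢ β = dom β ⊆ dom α × (∀ {x} → x ∈ dom β → α x ≡ β x)

  data Act : Set where
    _←ⁿ_ : Var → Val → Act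
    _←ᵛ_ : Var → Var → Act

  infix 10 _≕_

  data Obs : Set where
    _≕_ : Var → Val → Obs

  infix  9 ∁_
  infixr 8 _∧_
  infixr 7 _∨_

  data 𝒪 : Set where
    bot top : 𝒪
    obs     : Obs → 𝒪
    _∨_ _∧_ : 𝒪 → 𝒪 → 𝒪
    ∁_      : 𝒪 → 𝒪

  DownwardsClosed : Pred State 0ℓ → Set
  DownwardsClosed Z = ∀ {α β} → α ≤ˢ β → β ∈ Z → α ∈ Z

  -- In the clause for ∁ the union ranges over level-0 subsets Z, by
  -- predicativity.  Larger Z would contribute nothing more: ⟦ p ⟧ᴼᴬ ∩ Z = ∅
  -- passes to the level-0 principal downset of each element of Z.
  ⟦_⟧ᴼᴬ : 𝒪 → Pred State (lsuc 0ℓ)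
  ⟦ bot ⟧ᴼᴬ         = ∅
  ⟦ top ⟧ᴼᴬ         = U
  ⟦ obs (v ≕ n) ⟧ᴼᴬ = λ α → Lift _ (α v ≡ just n)
  ⟦ p ∨ q ⟧ᴼᴬ       = ⟦ p ⟧ᴼᴬ ∪ ⟦ q ⟧ᴼᴬ
  ⟦ p ∧ q ⟧ᴼᴬ       = ⟦ p ⟧ᴼᴬ ∩ ⟦ q ⟧ᴼᴬ
  ⟦ ∁ p ⟧ᴼᴬ         = λ α →
    Σ (Pred State 0ℓ) λ Z → DownwardsClosed Z × Empty (⟦ p ⟧ᴼᴬ ∩ Z) × α ∈ Z

  ⋁ ⋀ : List 𝒪 → 𝒪
  ⋁ = foldr _∨_ bot
  ⋀ = foldr _∧_ top

  valuesOtherThan : Val → List Val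
  valuesOtherThan n = filter (λ m → ¬? (finite⇒≟ finVal m n)) (enumerate finVal)

  infix 4 _≡ᴼᴬ_ _≦ᴼᴬ_

  data _≡ᴼᴬ_ : Rel 𝒪 0ℓ
  _≦ᴼᴬ_ : Rel 𝒪 0ℓ
  p ≦ᴼᴬ q = p ∨ q ≡ᴼᴬ q

  data _≡ᴼᴬ_ where
    reflexivity  : ∀ {p} → p ≡ᴼᴬ p
    symmetry     : ∀ {p q} → p ≡ᴼᴬ q → q ≡ᴼᴬ p
    transitivity : ∀ {p q r} → p ≡ᴼᴬ q → q ≡ᴼᴬ r → p ≡ᴼᴬ r
    ∨-cong       : ∀ {p p′ q q′} → p ≡ᴼᴬ p′ → q ≡ᴼᴬ q′ → p ∨ q ≡ᴼᴬ p′ ∨ q′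
    ∧-cong       : ∀ {p p′ q q′} → p ≡ᴼᴬ p′ → q ≡ᴼᴬ q′ → p ∧ q ≡ᴼᴬ p′ ∧ q′
    ∁-cong       : ∀ {p p′} → p ≡ᴼᴬ p′ → ∁ p ≡ᴼᴬ ∁ p′

    ∨-assoc       : ∀ p q r → (p ∨ q) ∨ r ≡ᴼᴬ p ∨ (q ∨ r)
    ∧-assoc       : ∀ p q r → (p ∧ q) ∧ r ≡ᴼᴬ p ∧ (q ∧ r)
    ∨-comm        : ∀ p q → p ∨ q ≡ᴼᴬ q ∨ p
    ∧-comm        : ∀ p q → p ∧ q ≡ᴼᴬ q ∧ p
    ∨-absorbs-∧   : ∀ p q → p ∨ (p ∧ q) ≡ᴼᴬ p
    ∧-absorbs-∨   : ∀ p q → p ∧ (p ∨ q) ≡ᴼᴬ p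
    ∨-distrib-∧   : ∀ p q r → p ∨ (q ∧ r) ≡ᴼᴬ (p ∨ q) ∧ (p ∨ r)
    ∧-distrib-∨   : ∀ p q r → p ∧ (q ∨ r) ≡ᴼᴬ (p ∧ q) ∨ (p ∧ r)
    ∨-identity    : ∀ p → p ∨ bot ≡ᴼᴬ p
    ∧-identity    : ∀ p → p ∧ top ≡ᴼᴬ p

    ≦∁⇒disjoint   : ∀ {p q} → p ≦ᴼᴬ ∁ q → p ∧ q ≡ᴼᴬ bot
    disjoint⇒≦∁   : ∀ {p q} → p ∧ q ≡ᴼᴬ bot → p ≦ᴼᴬ ∁ q

    single-valued : ∀ v {n m} → n ≢ m → obs (v ≕ n) ∧ obs (v ≕ m) ≡ᴼᴬ bot
    other-value   : ∀ v n →
      ∁ obs (v ≕ n) ≦ᴼᴬ ⋁ (map (λ m → obs (v ≕ m)) (valuesOtherThan n))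
    ∁-⋀           : ∀ {k} (v : Fin k → Var) (n : Fin k → Val) →
      Injective _≡_ _≡_ v →
      ∁ ⋀ (tabulate λ i → obs (v i ≕ n i)) ≦ᴼᴬ ⋁ (tabulate λ i → ∁ obs (v i ≕ n i))

  𝒯 : Set
  𝒯 = Term (Act ⊎ 𝒪)

  pattern act a  = letter (inj₁ a)
  pattern test p = letter (inj₂ p)

  infix 4 _≡ᵀ_ _≦ᵀ_

  data _≡ᵀ_ : Rel 𝒯 0ℓ
  _≦ᵀ_ : Rel 𝒯 0ℓ
  e ≦ᵀ f = e ⊹ f ≡ᵀ f

  data _≡ᵀ_ where
    reflexivity  : ∀ {e} → e ≡ᵀ e
    symmetry     : ∀ {e f} → e ≡ᵀ f → f ≡ᵀ e
    transitivity : ∀ {e f g} → e ≡ᵀ f → f ≡ᵀ g → e ≡ᵀ g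
    ⊹-cong       : ∀ {e e′ f f′} → e ≡ᵀ e′ → f ≡ᵀ f′ → e ⊹ f ≡ᵀ e′ ⊹ f′
    ·-cong       : ∀ {e e′ f f′} → e ≡ᵀ e′ → f ≡ᵀ f′ → e · f ≡ᵀ e′ · f′
    ∥-cong       : ∀ {e e′ f f′} → e ≡ᵀ e′ → f ≡ᵀ f′ → e ∥ f ≡ᵀ e′ ∥ f′
    ⋆-cong       : ∀ {e e′} → e ≡ᵀ e′ → e ⋆ ≡ᵀ e′ ⋆

    OA : ∀ {p q} → p ≡ᴼᴬ q → test p ≡ᵀ test q

    ⊹-assoc      : ∀ e f g → (e ⊹ f) ⊹ g ≡ᵀ e ⊹ (f ⊹ g)
    ⊹-comm       : ∀ e f → e ⊹ f ≡ᵀ f ⊹ e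
    ⊹-idem       : ∀ e → e ⊹ e ≡ᵀ e
    ⊹-identity   : ∀ e → e ⊹ 𝟘 ≡ᵀ e
    ·-assoc      : ∀ e f g → (e · f) · g ≡ᵀ e · (f · g)
    ·-identityˡ  : ∀ e → 𝟙 · e ≡ᵀ e
    ·-identityʳ  : ∀ e → e · 𝟙 ≡ᵀ e
    ·-zeroˡ      : ∀ e → 𝟘 · e ≡ᵀ 𝟘
    ·-zeroʳ      : ∀ e → e · 𝟘 ≡ᵀ 𝟘
    ·-distribˡ-⊹ : ∀ e f g → e · (f ⊹ g) ≡ᵀ e · f ⊹ e · g
    ·-distribʳ-⊹ : ∀ e f g → (e ⊹ f) · g ≡ᵀ e · g ⊹ f · g
    ⋆-unfoldˡ    : ∀ e → e ⋆ ≡ᵀ 𝟙 ⊹ e · e ⋆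
    ⋆-unfoldʳ    : ∀ e → e ⋆ ≡ᵀ 𝟙 ⊹ e ⋆ · e
    ⋆-inductʳ    : ∀ {e f g} → e ⊹ f · g ≦ᵀ f → e · g ⋆ ≦ᵀ f
    ⋆-inductˡ    : ∀ {e f g} → e ⊹ f · g ≦ᵀ g → f ⋆ · e ≦ᵀ g

    ∥-assoc      : ∀ e f g → (e ∥ f) ∥ g ≡ᵀ e ∥ (f ∥ g)
    ∥-comm       : ∀ e f → e ∥ f ≡ᵀ f ∥ e
    ∥-identity   : ∀ e → e ∥ 𝟙 ≡ᵀ e
    ∥-zero       : ∀ e → e ∥ 𝟘 ≡ᵀ 𝟘
    ∥-distrib-⊹  : ∀ e f g → e ∥ (f ⊹ g) ≡ᵀ e ∥ f ⊹ e ∥ g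

    exchange     : ∀ e f g h → (e ∥ f) · (g ∥ h) ≦ᵀ (e · g) ∥ (f · h)

    ∧≦·          : ∀ p q → test (p ∧ q) ≦ᵀ test p · test q
    ∨≡⊹          : ∀ p q → test (p ∨ q) ≡ᵀ test p ⊹ test q
    𝟘≡bot        : 𝟘 ≡ᵀ test bot
    top·test     : ∀ p → test top · test p ≦ᵀ test p
    test·top     : ∀ p → test p · test top ≦ᵀ test p
    top·act      : ∀ a → test top · act a ≦ᵀ act a
    act·top      : ∀ a → act a · test top ≦ᵀ act a

  Act∪State : Alphabet
  Act∪State = ⊎-setoid (setoid Act) (Var →-setoid Maybe Val)

  states : Pred State (lsuc 0ℓ) → Language Act∪State
  states P V = ∃[ α ] (α ∈ P × V ≅ ⟨ inj₂ α ⟩)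

  State* : Language Act∪State
  State* = states U *ᴸ

  ⦅_⦆ : 𝒯 → Language Act∪State
  ⦅ 𝟘 ⦆      = ∅
  ⦅ 𝟙 ⦆      = ｛ 1ᴾ ｝
  ⦅ act a ⦆  = State* ·ᴸ ｛ ⟨ inj₁ a ⟩ ｝ ·ᴸ State*
  ⦅ test p ⦆ = State* ·ᴸ states ⟦ p ⟧ᴼᴬ ·ᴸ State*
  ⦅ e ⊹ f ⦆  = ⦅ e ⦆ ∪ ⦅ f ⦆
  ⦅ e · f ⦆  = ⦅ e ⦆ ·ᴸ ⦅ f ⦆
  ⦅ e ∥ f ⦆  = ⦅ e ⦆ ∥ᴸ ⦅ f ⦆
  ⦅ e ⋆ ⦆    = ⦅ e ⦆ *ᴸ

  data exch : Rel (Term (Act ⊎ State)) 0ℓ where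
    exch-≤ : ∀ e f g h → exch ((e ∥ f) · (g ∥ h)) ((e · g) ∥ (f · h))

  data contr : Rel (Term (Act ⊎ State)) 0ℓ where
    contr-≤ : ∀ α → contr (letter (inj₂ α)) (letter (inj₂ α) · letter (inj₂ α))

  ⦅_⦆↓ : 𝒯 → Language Act∪State
  ⦅ e ⦆↓ = ⦅ e ⦆ ↓[ exch ∪ʰ contr ]

{-# OPTIONS --safe #-}

-- "L ⊆ K↓" is a precongruence on languages of series-parallel pomsets: a step of
-- the closure inside V extends to a step inside V · W, by composing its context
-- with W.  Every axiom holds for the induced equivalence.  Apart from the exchange
-- law and p ∧ q ≦ p · q (a contraction), the axioms even hold before closure.
module Submission where

open import Defs
open import Data.Empty using (⊥; ⊥-elim)
open import Data.Fin.Base using (Fin; zero; suc)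
open import Data.Fin.Properties using (any?)
open import Data.List.Base using (map; tabulate)
open import Data.List.Membership.Propositional using () renaming (_∈_ to _∈ˡ_)
open import Data.List.Membership.Propositional.Properties
  using (∈-map⁺; ∈-filter⁺; ∈-allFin; ∈-tabulate⁺)
open import Data.List.Relation.Unary.Any using (here; there)
open import Data.Maybe.Base using (Maybe; just; nothing)
open import Data.Maybe.Properties using (just-injective)
import Data.Maybe.Relation.Binary.Pointwise as MaybePW
open import Data.Nat.Base using (zero; suc)
open import Data.Product using (Σ; ∃-syntax; ∃!; _×_; _,_; proj₁; proj₂; swap)
open import Data.Sum.Base as Sum
  using (_⊎_; inj₁; inj₂; assocʳ; assocˡ) renaming ([_,_] to either; [_,_]′ to either′)
open import Data.Sum.Algebra using (⊎-comm; ⊎-cong)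
open import Data.Sum.Properties using (inj₁-injective; inj₂-injective)
open import Data.Sum.Relation.Binary.LeftOrder using (_⊎-<_; ₁∼₁; ₁∼₂; ₂∼₂)
open import Data.Sum.Relation.Binary.Pointwise as SumPW using (inj₁; inj₂)
open import Data.Unit.Base using (tt)
open import Function.Base using (id; _∘_)
open import Function.Bundles
  using (_↔_; mk↔ₛ′; mk⇔; module Inverse; module Equivalence)
open import Function.Definitions using (Injective)
open import Function.Properties.Inverse using (↔-refl; ↔-sym; ↔-trans)
open import Level using (0ℓ; lift; lower) renaming (suc to lsuc)
open import Relation.Binary.Bundles using (Setoid)
open import Relation.Binary.Construct.Union using () renaming (_∪_ to _∪ʰ_)
open import Relation.Binary.Core using (Rel)
open import Relation.Binary.Definitions using (_Respects_)
open import Relation.Binary.PropositionalEquality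
  using (_≡_; _≢_; refl; sym; trans; cong; cong′; subst; subst₂)
open import Relation.Binary.Structures using (IsPartialOrder)
open import Relation.Nullary using (Dec; yes; no; ¬_; contradiction)
open import Relation.Nullary.Decidable using (¬?)
open import Relation.Unary using (Pred; _∈_; _⊆_; _∩_; _∪_; _≐_)
open import Relation.Unary.Properties using (≐-refl; ≐-sym; ≐-trans)

-- Isomorphism of pomsets

module _ {S : Alphabet} where

  private
    module S = Setoid S

    variable
      V V′ W W′ X : Pomset S

  -- Reflection of the order is traded for monotonicity of the inverse bijection, which can be
  -- checked by matching on order proofs. The two agree because `from` undoes `to`.
  mk≅ : {V W : Pomset S} (I : Pomset.Node V ↔ Pomset.Node W) →
        (∀ {x y} → Pomset._≼_ V x y → Pomset._≼_ W (Inverse.to I x) (Inverse.to I y)) →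
        (∀ {x y} → Pomset._≼_ W x y → Pomset._≼_ V (Inverse.from I x) (Inverse.from I y)) →
        (∀ x → Pomset.label V x S.≈ Pomset.label W (Inverse.to I x)) →
        V ≅ W
  mk≅ {V} I to-mono from-mono labels = record
    { nodes  = I
    ; orders = λ x y → mk⇔ to-mono
        (subst₂ (Pomset._≼_ V) (Inverse.strictlyInverseʳ I x) (Inverse.strictlyInverseʳ I y)
          ∘ from-mono)
    ; labels = labels
    }

  to-mono : (i : V ≅ W) → ∀ {x y} → Pomset._≼_ V x y →
            Pomset._≼_ W (Inverse.to (_≅_.nodes i) x) (Inverse.to (_≅_.nodes i) y)
  to-mono i = Equivalence.to (_≅_.orders i _ _)

  from-mono : (i : V ≅ W) → ∀ {x y} → Pomset._≼_ W x y →
              Pomset._≼_ V (Inverse.from (_≅_.nodes i) x) (Inverse.from (_≅_.nodes i) y)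
  from-mono {W = W} i = Equivalence.from (_≅_.orders i _ _) ∘
    subst₂ (Pomset._≼_ W) (sym (strictlyInverseˡ _)) (sym (strictlyInverseˡ _))
    where open Inverse (_≅_.nodes i)

  ≅-refl : V ≅ V
  ≅-refl = mk≅ ↔-refl id id (λ _ → S.refl)

  ≅-sym : V ≅ W → W ≅ V
  ≅-sym {W = W} i = mk≅ (↔-sym (_≅_.nodes i)) (from-mono i) (to-mono i)
    (λ x → S.sym (S.trans (_≅_.labels i (from x))
                          (S.reflexive (cong (Pomset.label W) (strictlyInverseˡ x)))))
    where open Inverse (_≅_.nodes i)

  ≅-trans : V ≅ W → W ≅ X → V ≅ X
  ≅-trans i j = mk≅ (↔-trans (_≅_.nodes i) (_≅_.nodes j))
    (to-mono j ∘ to-mono i) (from-mono i ∘ from-mono j)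
    (λ x → S.trans (_≅_.labels i x) (_≅_.labels j _))

  ⟨⟩-cong : ∀ {a b} → a S.≈ b → ⟨_⟩ {S} a ≅ ⟨ b ⟩
  ⟨⟩-cong a≈b = mk≅ ↔-refl id id (λ _ → a≈b)

  ·ᴾ-cong : V ≅ V′ → W ≅ W′ → V ·ᴾ W ≅ V′ ·ᴾ W′
  ·ᴾ-cong i j = mk≅ (⊎-cong (_≅_.nodes i) (_≅_.nodes j))
    (λ { ₁∼₂ → ₁∼₂ ; (₁∼₁ p) → ₁∼₁ (to-mono i p) ; (₂∼₂ p) → ₂∼₂ (to-mono j p) })
    (λ { ₁∼₂ → ₁∼₂ ; (₁∼₁ p) → ₁∼₁ (from-mono i p) ; (₂∼₂ p) → ₂∼₂ (from-mono j p) })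
    (either (_≅_.labels i) (_≅_.labels j))

  ∥ᴾ-cong : V ≅ V′ → W ≅ W′ → V ∥ᴾ W ≅ V′ ∥ᴾ W′
  ∥ᴾ-cong i j = mk≅ (⊎-cong (_≅_.nodes i) (_≅_.nodes j))
    (λ { (inj₁ p) → inj₁ (to-mono i p) ; (inj₂ p) → inj₂ (to-mono j p) })
    (λ { (inj₁ p) → inj₁ (from-mono i p) ; (inj₂ p) → inj₂ (from-mono j p) })
    (either (_≅_.labels i) (_≅_.labels j))

  private
    ⊎-assoc-↔ : {A B C : Set} → ((A ⊎ B) ⊎ C) ↔ (A ⊎ (B ⊎ C))
    ⊎-assoc-↔ = mk↔ₛ′ assocʳ assocˡ
      (either cong′ (either cong′ cong′)) (either (either cong′ cong′) cong′)

    ⊎-identityˡ-↔ : {A : Set} → (⊥ ⊎ A) ↔ A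
    ⊎-identityˡ-↔ = mk↔ₛ′ (either (λ ()) id) inj₂ cong′ (either (λ ()) cong′)

    ⊎-identityʳ-↔ : {A : Set} → (A ⊎ ⊥) ↔ A
    ⊎-identityʳ-↔ = mk↔ₛ′ (either id (λ ())) inj₁ cong′ (either cong′ (λ ()))

  ·ᴾ-assoc : (V ·ᴾ W) ·ᴾ X ≅ V ·ᴾ (W ·ᴾ X)
  ·ᴾ-assoc = mk≅ ⊎-assoc-↔
    (λ { (₁∼₁ (₁∼₁ p)) → ₁∼₁ p
       ; (₁∼₁ ₁∼₂) → ₁∼₂
       ; (₁∼₁ (₂∼₂ p)) → ₂∼₂ (₁∼₁ p)
       -- The lower node lies in `V ·ᴾ W`. From `V` it stays below the whole second factor, from `W`
       -- the inequality moves inside `W ·ᴾ X`; hence the match on the implicit node.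
       ; (₁∼₂ {inj₁ _}) → ₁∼₂
       ; (₁∼₂ {inj₂ _}) → ₂∼₂ ₁∼₂
       ; (₂∼₂ p) → ₂∼₂ (₂∼₂ p) })
    (λ { (₁∼₁ p) → ₁∼₁ (₁∼₁ p)
       ; (₁∼₂ {_} {inj₁ _}) → ₁∼₁ ₁∼₂
       ; (₁∼₂ {_} {inj₂ _}) → ₁∼₂
       ; (₂∼₂ (₁∼₁ p)) → ₁∼₁ (₂∼₂ p)
       ; (₂∼₂ ₁∼₂) → ₁∼₂
       ; (₂∼₂ (₂∼₂ p)) → ₂∼₂ p })
    (either (either (λ _ → S.refl) (λ _ → S.refl)) (λ _ → S.refl))

  ∥ᴾ-assoc : (V ∥ᴾ W) ∥ᴾ X ≅ V ∥ᴾ (W ∥ᴾ X)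
  ∥ᴾ-assoc = mk≅ ⊎-assoc-↔
    (λ { (inj₁ (inj₁ p)) → inj₁ p
       ; (inj₁ (inj₂ p)) → inj₂ (inj₁ p)
       ; (inj₂ p) → inj₂ (inj₂ p) })
    (λ { (inj₁ p) → inj₁ (inj₁ p)
       ; (inj₂ (inj₁ p)) → inj₁ (inj₂ p)
       ; (inj₂ (inj₂ p)) → inj₂ p })
    (either (either (λ _ → S.refl) (λ _ → S.refl)) (λ _ → S.refl))

  ∥ᴾ-comm : V ∥ᴾ W ≅ W ∥ᴾ V
  ∥ᴾ-comm = mk≅ (⊎-comm _ _)
    (λ { (inj₁ p) → inj₂ p ; (inj₂ p) → inj₁ p })
    (λ { (inj₁ p) → inj₂ p ; (inj₂ p) → inj₁ p })
    (either (λ _ → S.refl) (λ _ → S.refl))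

  ·ᴾ-identityˡ : 1ᴾ ·ᴾ V ≅ V
  ·ᴾ-identityˡ = mk≅ ⊎-identityˡ-↔ (λ { (₂∼₂ p) → p }) ₂∼₂ (either (λ ()) (λ _ → S.refl))

  ·ᴾ-identityʳ : V ·ᴾ 1ᴾ ≅ V
  ·ᴾ-identityʳ = mk≅ ⊎-identityʳ-↔ (λ { (₁∼₁ p) → p }) ₁∼₁ (either (λ _ → S.refl) (λ ()))

  ∥ᴾ-identityʳ : V ∥ᴾ 1ᴾ ≅ V
  ∥ᴾ-identityʳ = mk≅ ⊎-identityʳ-↔ (λ { (inj₁ p) → p }) inj₁ (either (λ _ → S.refl) (λ ()))

-- Substitution in pomsets and pomset contexts

module _ {S : Alphabet} where

  private
    module S = Setoid S

    variable
      V W : Pomset S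

  open Substitution using (outer; inner; substitute)

  private
    Σ-⊎-↔ : {A B : Set} {P : A ⊎ B → Set} →
            Σ (A ⊎ B) P ↔ (Σ A (P ∘ inj₁) ⊎ Σ B (P ∘ inj₂))
    Σ-⊎-↔ = mk↔ₛ′
      (λ { (inj₁ x , i) → inj₁ (x , i) ; (inj₂ x , i) → inj₂ (x , i) })
      (either (λ (x , i) → inj₁ x , i) (λ (x , i) → inj₂ x , i))
      (either cong′ cong′)
      (λ { (inj₁ _ , _) → refl ; (inj₂ _ , _) → refl })

  -- Blocks never straddle the two factors, so `inner` inequalities stay within one of them. Nodes
  -- of different factors are distinct, which gives `outer` its disequality.
  substitute-· : (C D : Pomset (S ∪*)) (V : Pomset S) →
                 substitute (C ·ᴾ D) V ≅ substitute C V ·ᴾ substitute D V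
  substitute-· C D V = mk≅ I forward backward labels
    where
    module C = Substitution C V
    module D = Substitution D V
    module C·D = Substitution (C ·ᴾ D) V

    I : C·D.SNode ↔ (C.SNode ⊎ D.SNode)
    I = Σ-⊎-↔

    forward : ∀ {s t} → s C·D.⊑ t → (C._⊑_ ⊎-< D._⊑_) (Inverse.to I s) (Inverse.to I t)
    forward (outer ₁∼₂ _)         = ₁∼₂
    forward (outer (₁∼₁ p) x≢y)   = ₁∼₁ (C.outer p (x≢y ∘ cong inj₁))
    forward (outer (₂∼₂ p) x≢y)   = ₂∼₂ (D.outer p (x≢y ∘ cong inj₂))
    forward (inner {inj₁ _} p)    = ₁∼₁ (C.inner p)
    forward (inner {inj₂ _} p)    = ₂∼₂ (D.inner p)

    backward : ∀ {s t} → (C._⊑_ ⊎-< D._⊑_) s t → Inverse.from I s C·D.⊑ Inverse.from I t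
    backward ₁∼₂                  = C·D.outer ₁∼₂ (λ ())
    backward (₁∼₁ (outer p x≢y))  = C·D.outer (₁∼₁ p) (x≢y ∘ inj₁-injective)
    backward (₁∼₁ (inner p))      = C·D.inner p
    backward (₂∼₂ (outer p x≢y))  = C·D.outer (₂∼₂ p) (x≢y ∘ inj₂-injective)
    backward (₂∼₂ (inner p))      = C·D.inner p

    labels : ∀ s → Pomset.label (substitute (C ·ᴾ D) V) s S.≈
                   Pomset.label (substitute C V ·ᴾ substitute D V) (Inverse.to I s)
    labels (inj₁ _ , _) = S.refl
    labels (inj₂ _ , _) = S.refl

  substitute-∥ : (C D : Pomset (S ∪*)) (V : Pomset S) →
                 substitute (C ∥ᴾ D) V ≅ substitute C V ∥ᴾ substitute D V
  substitute-∥ C D V = mk≅ I forward backward labels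
    where
    module C = Substitution C V
    module D = Substitution D V
    module C∥D = Substitution (C ∥ᴾ D) V

    I : C∥D.SNode ↔ (C.SNode ⊎ D.SNode)
    I = Σ-⊎-↔

    forward : ∀ {s t} → s C∥D.⊑ t → SumPW.Pointwise C._⊑_ D._⊑_ (Inverse.to I s) (Inverse.to I t)
    forward (outer (inj₁ p) x≢y)  = inj₁ (C.outer p (x≢y ∘ cong inj₁))
    forward (outer (inj₂ p) x≢y)  = inj₂ (D.outer p (x≢y ∘ cong inj₂))
    forward (inner {inj₁ _} p)    = inj₁ (C.inner p)
    forward (inner {inj₂ _} p)    = inj₂ (D.inner p)

    backward : ∀ {s t} → SumPW.Pointwise C._⊑_ D._⊑_ s t → Inverse.from I s C∥D.⊑ Inverse.from I t
    backward (inj₁ (outer p x≢y)) = C∥D.outer (inj₁ p) (x≢y ∘ inj₁-injective)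
    backward (inj₁ (inner p))     = C∥D.inner p
    backward (inj₂ (outer p x≢y)) = C∥D.outer (inj₂ p) (x≢y ∘ inj₂-injective)
    backward (inj₂ (inner p))     = C∥D.inner p

    labels : ∀ s → Pomset.label (substitute (C ∥ᴾ D) V) s S.≈
                   Pomset.label (substitute C V ∥ᴾ substitute D V) (Inverse.to I s)
    labels (inj₁ _ , _) = S.refl
    labels (inj₂ _ , _) = S.refl

  -- Only the alphabet gains a hole letter; no node carries it. This lets a fixed pomset surround
  -- the hole of a context.
  addHole : Pomset S → Pomset (S ∪*)
  addHole V = record
    { Node           = Pomset.Node V
    ; finite         = Pomset.finite V
    ; _≼_            = Pomset._≼_ V
    ; isPartialOrder = Pomset.isPartialOrder V
    ; label          = just ∘ Pomset.label V
    }

  -- The identity on nodes is an isomorphism at every constructor, but for products the two label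
  -- functions agree only pointwise, so each case passes through `iso`.
  addHole-SP : SP V → SP (addHole V)
  addHole-SP one        = iso (mk≅ ↔-refl id id (λ ())) one
  addHole-SP (letter a) = iso (mk≅ ↔-refl id id (λ _ → Setoid.refl (S ∪*))) (letter (just a))
  addHole-SP (seq v w)  = iso
    (mk≅ ↔-refl id id (either (λ _ → Setoid.refl (S ∪*)) (λ _ → Setoid.refl (S ∪*))))
    (seq (addHole-SP v) (addHole-SP w))
  addHole-SP (par v w)  = iso
    (mk≅ ↔-refl id id (either (λ _ → Setoid.refl (S ∪*)) (λ _ → Setoid.refl (S ∪*))))
    (par (addHole-SP v) (addHole-SP w))
  addHole-SP (iso i v)  = iso
    (mk≅ (_≅_.nodes i) (to-mono i) (from-mono i) (MaybePW.just ∘ _≅_.labels i))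
    (addHole-SP v)

  substitute-addHole : (W V : Pomset S) → substitute (addHole W) V ≅ W
  substitute-addHole W V = mk≅
    (mk↔ₛ′ proj₁ (_, tt) cong′ cong′)
    (λ { (outer p _) → p ; (inner _) → IsPartialOrder.refl (Pomset.isPartialOrder W) })
    reflect
    (λ _ → S.refl)
    where
    open module W = Substitution (addHole W) V using (_⊑_)

    reflect : ∀ {x y} → Pomset._≼_ W x y → (x , tt) ⊑ (y , tt)
    -- `outer` demands distinct nodes and `inner` a single one, so an inequality of `W` can be
    -- placed only after deciding equality of its ends. Finiteness of `W` makes this decidable.
    reflect {x} {y} p with finite⇒≟ (Pomset.finite W) x y
    ... | yes refl = W.inner tt
    ... | no x≢y   = W.outer p x≢y

  -- The trivial context, and contexts composed with a pomset

  □ : PC S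
  □ = record
    { pomset = ⟨ nothing ⟩
    ; isSP   = letter nothing
    ; hole   = tt , refl , λ _ → refl
    }

  □-[] : ∀ V → □ [ V ] ≅ V
  □-[] V = mk≅ (mk↔ₛ′ proj₂ (tt ,_) cong′ cong′)
    (λ { (outer _ tt≢tt) → ⊥-elim (tt≢tt refl) ; (inner p) → p })
    □.inner (λ _ → S.refl)
    where module □ = Substitution (PC.pomset □) V

  private
    -- The added summand is labelled through `just`, so it cannot contribute a second hole.
    hole-inj₁ : {A B : Set} {f : A → Maybe S.Carrier} {g : B → S.Carrier} →
                ∃! _≡_ (λ x → f x ≡ nothing) →
                ∃! _≡_ (λ x → either′ f (just ∘ g) x ≡ nothing)
    hole-inj₁ (x , eq , unique) =
      inj₁ x , eq , λ { {inj₁ _} eq′ → cong inj₁ (unique eq′) ; {inj₂ _} () }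

    hole-inj₂ : {A B : Set} {f : A → Maybe S.Carrier} {g : B → S.Carrier} →
                ∃! _≡_ (λ x → f x ≡ nothing) →
                ∃! _≡_ (λ x → either′ (just ∘ g) f x ≡ nothing)
    hole-inj₂ (x , eq , unique) =
      inj₂ x , eq , λ { {inj₂ _} eq′ → cong inj₂ (unique eq′) ; {inj₁ _} () }

  seqˡ : PC S → SP W → PC S
  seqˡ {W} C w = record
    { pomset = PC.pomset C ·ᴾ addHole W
    ; isSP   = seq (PC.isSP C) (addHole-SP w)
    ; hole   = hole-inj₁ (PC.hole C)
    }

  seqʳ : SP V → PC S → PC S
  seqʳ {V} v C = record
    { pomset = addHole V ·ᴾ PC.pomset C
    ; isSP   = seq (addHole-SP v) (PC.isSP C)
    ; hole   = hole-inj₂ (PC.hole C)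
    }

  parˡ : PC S → SP W → PC S
  parˡ {W} C w = record
    { pomset = PC.pomset C ∥ᴾ addHole W
    ; isSP   = par (PC.isSP C) (addHole-SP w)
    ; hole   = hole-inj₁ (PC.hole C)
    }

  -- Checking P [ V ] against a substitution into C ·ᴾ D by conversion unfolds the
  -- finiteness proofs, which the equation avoids.
  []-· : (P : PC S) {C D : Pomset (S ∪*)} → PC.pomset P ≡ C ·ᴾ D →
         P [ V ] ≅ substitute C V ·ᴾ substitute D V
  []-· {V} P {C} {D} eq = subst (λ E → substitute E V ≅ _) (sym eq) (substitute-· C D V)

  []-∥ : (P : PC S) {C D : Pomset (S ∪*)} → PC.pomset P ≡ C ∥ᴾ D →
         P [ V ] ≅ substitute C V ∥ᴾ substitute D V
  []-∥ {V} P {C} {D} eq = subst (λ E → substitute E V ≅ _) (sym eq) (substitute-∥ C D V)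

  -- Filling the hole leaves `W` untouched, so a closure step in context `C`, followed by `W`, is a
  -- closure step in context `seqˡ C w`.
  seqˡ-[] : (C : PC S) (w : SP W) → seqˡ C w [ V ] ≅ C [ V ] ·ᴾ W
  seqˡ-[] {W} {V} C w =
    ≅-trans ([]-· (seqˡ C w) refl) (·ᴾ-cong (≅-refl {V = C [ V ]}) (substitute-addHole W V))

  seqʳ-[] : (w : SP W) (C : PC S) → seqʳ w C [ V ] ≅ W ·ᴾ C [ V ]
  seqʳ-[] {W} {V} w C =
    ≅-trans ([]-· (seqʳ w C) refl) (·ᴾ-cong (substitute-addHole W V) (≅-refl {V = C [ V ]}))

  parˡ-[] : (C : PC S) (w : SP W) → parˡ C w [ V ] ≅ C [ V ] ∥ᴾ W
  parˡ-[] {W} {V} C w =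
    ≅-trans ([]-∥ (parˡ C w) refl) (∥ᴾ-cong (≅-refl {V = C [ V ]}) (substitute-addHole W V))

-- Pomset languages

module _ {S : Alphabet} where

  private
    variable
      L L′ K K′ M : Language S
      V           : Pomset S

  ·ᴸ-mono : L ⊆ L′ → K ⊆ K′ → L ·ᴸ K ⊆ L′ ·ᴸ K′
  ·ᴸ-mono L⊆L′ K⊆K′ (V , W , v , w , i) = V , W , L⊆L′ v , K⊆K′ w , i

  ∥ᴸ-mono : L ⊆ L′ → K ⊆ K′ → L ∥ᴸ K ⊆ L′ ∥ᴸ K′
  ∥ᴸ-mono L⊆L′ K⊆K′ (V , W , v , w , i) = V , W , L⊆L′ v , K⊆K′ w , i

  ·ᴸ-respects : (L ·ᴸ K) Respects _≅_
  ·ᴸ-respects i (V , W , v , w , j) = V , W , v , w , ≅-trans (≅-sym i) j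

  ∥ᴸ-respects : (L ∥ᴸ K) Respects _≅_
  ∥ᴸ-respects i (V , W , v , w , j) = V , W , v , w , ≅-trans (≅-sym i) j

  ·ᴸ-assoc : (L ·ᴸ K) ·ᴸ M ≐ L ·ᴸ (K ·ᴸ M)
  ·ᴸ-assoc =
    (λ (_ , X , (V , W , v , w , i) , x , j) →
      V , W ·ᴾ X , v , (W , X , w , x , ≅-refl) ,
      ≅-trans j (≅-trans (·ᴾ-cong i (≅-refl {V = X})) (·ᴾ-assoc {V = V} {W} {X}))) ,
    (λ (V , _ , v , (W , X , w , x , i) , j) →
      V ·ᴾ W , X , (V , W , v , w , ≅-refl) , x ,
      ≅-trans j (≅-trans (·ᴾ-cong (≅-refl {V = V}) i) (≅-sym (·ᴾ-assoc {V = V} {W} {X}))))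

  ∥ᴸ-assoc : (L ∥ᴸ K) ∥ᴸ M ≐ L ∥ᴸ (K ∥ᴸ M)
  ∥ᴸ-assoc =
    (λ (_ , X , (V , W , v , w , i) , x , j) →
      V , W ∥ᴾ X , v , (W , X , w , x , ≅-refl) ,
      ≅-trans j (≅-trans (∥ᴾ-cong i (≅-refl {V = X})) (∥ᴾ-assoc {V = V} {W} {X}))) ,
    (λ (V , _ , v , (W , X , w , x , i) , j) →
      V ∥ᴾ W , X , (V , W , v , w , ≅-refl) , x ,
      ≅-trans j (≅-trans (∥ᴾ-cong (≅-refl {V = V}) i) (≅-sym (∥ᴾ-assoc {V = V} {W} {X}))))

  ∥ᴸ-comm : L ∥ᴸ K ⊆ K ∥ᴸ L
  ∥ᴸ-comm (V , W , v , w , i) = W , V , w , v , ≅-trans i (∥ᴾ-comm {V = V} {W})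

  ·ᴸ-identityˡ : L Respects _≅_ → ｛ 1ᴾ ｝ ·ᴸ L ≐ L
  ·ᴸ-identityˡ resp =
    (λ (_ , V , lift i , v , j) →
      resp (≅-sym (≅-trans j (≅-trans (·ᴾ-cong i (≅-refl {V = V})) ·ᴾ-identityˡ))) v) ,
    (λ v → _ , _ , lift ≅-refl , v , ≅-sym ·ᴾ-identityˡ)

  ·ᴸ-identityʳ : L Respects _≅_ → L ·ᴸ ｛ 1ᴾ ｝ ≐ L
  ·ᴸ-identityʳ resp =
    (λ (V , _ , v , lift i , j) →
      resp (≅-sym (≅-trans j (≅-trans (·ᴾ-cong (≅-refl {V = V}) i) ·ᴾ-identityʳ))) v) ,
    (λ v → _ , _ , v , lift ≅-refl , ≅-sym ·ᴾ-identityʳ)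

  ∥ᴸ-identityʳ : L Respects _≅_ → L ∥ᴸ ｛ 1ᴾ ｝ ≐ L
  ∥ᴸ-identityʳ resp =
    (λ (V , _ , v , lift i , j) →
      resp (≅-sym (≅-trans j (≅-trans (∥ᴾ-cong (≅-refl {V = V}) i) ∥ᴾ-identityʳ))) v) ,
    (λ v → _ , _ , v , lift ≅-refl , ≅-sym ∥ᴾ-identityʳ)

  ·ᴸ-distribˡ-∪ : L ·ᴸ (K ∪ M) ≐ (L ·ᴸ K) ∪ (L ·ᴸ M)
  ·ᴸ-distribˡ-∪ =
    (λ { (V , W , v , inj₁ w , i) → inj₁ (V , W , v , w , i)
       ; (V , W , v , inj₂ w , i) → inj₂ (V , W , v , w , i) }) ,
    either′ (·ᴸ-mono id inj₁) (·ᴸ-mono id inj₂)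

  ·ᴸ-distribʳ-∪ : (L ∪ K) ·ᴸ M ≐ (L ·ᴸ M) ∪ (K ·ᴸ M)
  ·ᴸ-distribʳ-∪ =
    (λ { (V , W , inj₁ v , w , i) → inj₁ (V , W , v , w , i)
       ; (V , W , inj₂ v , w , i) → inj₂ (V , W , v , w , i) }) ,
    either′ (·ᴸ-mono inj₁ id) (·ᴸ-mono inj₂ id)

  ∥ᴸ-distribˡ-∪ : L ∥ᴸ (K ∪ M) ≐ (L ∥ᴸ K) ∪ (L ∥ᴸ M)
  ∥ᴸ-distribˡ-∪ =
    (λ { (V , W , v , inj₁ w , i) → inj₁ (V , W , v , w , i)
       ; (V , W , v , inj₂ w , i) → inj₂ (V , W , v , w , i) }) ,
    either′ (∥ᴸ-mono id inj₁) (∥ᴸ-mono id inj₂)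

  -- Powers are defined by multiplying on the left; this gives access to the last factor and hence
  -- the right unfolding of the star. Invariance under isomorphism enters at exponent zero, through
  -- the unit laws.
  ^ᴸ-comm : ∀ n → L Respects _≅_ → L ·ᴸ L ^ᴸ n ≐ L ^ᴸ n ·ᴸ L
  ^ᴸ-comm zero    resp = ≐-trans (·ᴸ-identityʳ resp) (≐-sym (·ᴸ-identityˡ resp))
  ^ᴸ-comm (suc n) resp = ≐-trans
    (·ᴸ-mono id (proj₁ (^ᴸ-comm n resp)) , ·ᴸ-mono id (proj₂ (^ᴸ-comm n resp)))
    (≐-sym ·ᴸ-assoc)

  *ᴸ-unfoldˡ : L *ᴸ ≐ ｛ 1ᴾ ｝ ∪ L ·ᴸ L *ᴸ
  *ᴸ-unfoldˡ =
    (λ { (zero , v) → inj₁ v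
       ; (suc n , V , W , v , w , i) → inj₂ (V , W , v , (n , w) , i) }) ,
    (λ { (inj₁ v) → zero , v
       ; (inj₂ (V , W , v , (n , w) , i)) → suc n , V , W , v , w , i })

  *ᴸ-unfoldʳ : L Respects _≅_ → L *ᴸ ≐ ｛ 1ᴾ ｝ ∪ L *ᴸ ·ᴸ L
  *ᴸ-unfoldʳ {L} resp = unfold , fold
    where
    unfold : L *ᴸ ⊆ ｛ 1ᴾ ｝ ∪ L *ᴸ ·ᴸ L
    unfold (zero  , v) = inj₁ v
    unfold (suc n , v) = inj₂ (·ᴸ-mono (n ,_) id (proj₁ (^ᴸ-comm n resp) v))

    fold : ｛ 1ᴾ ｝ ∪ L *ᴸ ·ᴸ L ⊆ L *ᴸ
    fold (inj₁ v)                       = zero , v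
    fold (inj₂ (V , W , (n , v) , w , i)) = suc n , proj₂ (^ᴸ-comm n resp) (V , W , v , w , i)

  1∈*ᴸ : 1ᴾ ∈ L *ᴸ
  1∈*ᴸ = zero , lift ≅-refl

  ⊆*ᴸ : L ⊆ L *ᴸ
  ⊆*ᴸ v = 1 , _ , _ , v , lift ≅-refl , ≅-sym ·ᴾ-identityʳ

  *ᴸ-respects : (L *ᴸ) Respects _≅_
  *ᴸ-respects i (zero  , lift j)            = zero , lift (≅-trans (≅-sym i) j)
  *ᴸ-respects i (suc n , V , W , v , w , j) = suc n , V , W , v , w , ≅-trans (≅-sym i) j

  -- Induction on the exponent of the left word, whose factors are pushed one at a time onto the
  -- right word.
  *ᴸ-·ᴸ-*ᴸ : L *ᴸ ·ᴸ L *ᴸ ⊆ L *ᴸ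
  *ᴸ-·ᴸ-*ᴸ {L} (V , W , (n , v) , w , i) = absorb n (V , W , v , w , i)
    where
    absorb : ∀ n → L ^ᴸ n ·ᴸ L *ᴸ ⊆ L *ᴸ
    absorb zero    x = proj₁ (·ᴸ-identityˡ *ᴸ-respects) x
    absorb (suc n) x = proj₂ *ᴸ-unfoldˡ (inj₂ (·ᴸ-mono id (absorb n) (proj₁ ·ᴸ-assoc x)))

  SP-·ᴸ : L ⊆ SP → K ⊆ SP → L ·ᴸ K ⊆ SP
  SP-·ᴸ L⊆SP K⊆SP (_ , _ , v , w , i) = iso (≅-sym i) (seq (L⊆SP v) (K⊆SP w))

  SP-∥ᴸ : L ⊆ SP → K ⊆ SP → L ∥ᴸ K ⊆ SP
  SP-∥ᴸ L⊆SP K⊆SP (_ , _ , v , w , i) = iso (≅-sym i) (par (L⊆SP v) (K⊆SP w))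

  SP-^ᴸ : L ⊆ SP → ∀ n → L ^ᴸ n ⊆ SP
  SP-^ᴸ L⊆SP zero    (lift i) = iso (≅-sym i) one
  SP-^ᴸ L⊆SP (suc n)          = SP-·ᴸ L⊆SP (SP-^ᴸ L⊆SP n)

  -- Hypotheses relate terms, whereas the argument concerns single pomsets. This term denotes
  -- exactly the isomorphism class of `V`, so `iso` can be skipped.
  toTerm : SP V → Term (Setoid.Carrier S)
  toTerm one        = 𝟙
  toTerm (letter a) = letter a
  toTerm (seq v w)  = toTerm v · toTerm w
  toTerm (par v w)  = toTerm v ∥ toTerm w
  toTerm (iso _ v)  = toTerm v

  ⟦toTerm⟧ : (v : SP V) → ⟦ toTerm v ⟧ᴮᴷᴬ ≐ ｛ V ｝
  ⟦toTerm⟧ one        = ≐-refl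
  ⟦toTerm⟧ (letter _) = ≐-refl
  ⟦toTerm⟧ (seq v w)  =
    (λ (_ , _ , x , y , i) → lift (≅-trans i
      (·ᴾ-cong (lower (proj₁ (⟦toTerm⟧ v) x)) (lower (proj₁ (⟦toTerm⟧ w) y))))) ,
    (λ (lift i) → _ , _ , proj₂ (⟦toTerm⟧ v) (lift ≅-refl) , proj₂ (⟦toTerm⟧ w) (lift ≅-refl) , i)
  ⟦toTerm⟧ (par v w)  =
    (λ (_ , _ , x , y , i) → lift (≅-trans i
      (∥ᴾ-cong (lower (proj₁ (⟦toTerm⟧ v) x)) (lower (proj₁ (⟦toTerm⟧ w) y))))) ,
    (λ (lift i) → _ , _ , proj₂ (⟦toTerm⟧ v) (lift ≅-refl) , proj₂ (⟦toTerm⟧ w) (lift ≅-refl) , i)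
  ⟦toTerm⟧ (iso i v)  =
    (λ x → lift (≅-trans (lower (proj₁ (⟦toTerm⟧ v) x)) i)) ,
    (λ (lift j) → proj₂ (⟦toTerm⟧ v) (lift (≅-trans j (≅-sym i))))

-- Closure under hypotheses

module _ {S : Alphabet} {H : Rel (Term (Setoid.Carrier S)) 0ℓ} where

  private
    variable
      L L′ K K′ M : Language S
      V W X       : Pomset S

  -- A derivation from `L` is replayed with its leaves replaced by derivations from `K`. This is
  -- what makes the relation `L ⊆ K ↓[ H ]` transitive.
  ↓-least : L ⊆ K ↓[ H ] → L ↓[ H ] ⊆ K ↓[ H ]
  ↓-least L⊆K↓ (incl v)      = L⊆K↓ v
  ↓-least L⊆K↓ (hyp h C s x) = hyp h C (λ y → ↓-least L⊆K↓ (s y)) x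

  ↓-mono : L ⊆ K → L ↓[ H ] ⊆ K ↓[ H ]
  ↓-mono L⊆K = ↓-least (λ x → incl (L⊆K x))

  ·ᴸ-↓ˡ : K ⊆ SP → (L ↓[ H ]) ·ᴸ K ⊆ (L ·ᴸ K) ↓[ H ]
  ·ᴸ-↓ˡ {K} {L} K⊆SP (_ , _ , v , w , i) = go v w i
    where
    -- The recursion is on the derivation for `V`: the premise `s` supplies a smaller derivation for
    -- every filling of `C`, and `X` varies with the filling.
    go : V ∈ L ↓[ H ] → W ∈ K → X ≅ V ·ᴾ W → X ∈ (L ·ᴸ K) ↓[ H ]
    go (incl v) w i = incl (_ , _ , v , w , i)
    go {W = W} (hyp h C s (Y , y , j)) w i =
      hyp h (seqˡ C (K⊆SP w))
        (λ (_ , z , k) → go (s (_ , z , ≅-refl)) w (≅-trans k (seqˡ-[] C (K⊆SP w))))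
        (Y , y , ≅-trans i (≅-trans (·ᴾ-cong j (≅-refl {V = W})) (≅-sym (seqˡ-[] C (K⊆SP w)))))

  ·ᴸ-↓ʳ : L ⊆ SP → L ·ᴸ (K ↓[ H ]) ⊆ (L ·ᴸ K) ↓[ H ]
  ·ᴸ-↓ʳ {L} {K} L⊆SP (_ , _ , v , w , i) = go v w i
    where
    go : V ∈ L → W ∈ K ↓[ H ] → X ≅ V ·ᴾ W → X ∈ (L ·ᴸ K) ↓[ H ]
    go v (incl w) i = incl (_ , _ , v , w , i)
    go {V = V} v (hyp h C s (Y , y , j)) i =
      hyp h (seqʳ (L⊆SP v) C)
        (λ (_ , z , k) → go v (s (_ , z , ≅-refl)) (≅-trans k (seqʳ-[] (L⊆SP v) C)))
        (Y , y , ≅-trans i (≅-trans (·ᴾ-cong (≅-refl {V = V}) j) (≅-sym (seqʳ-[] (L⊆SP v) C))))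

  ∥ᴸ-↓ˡ : K ⊆ SP → (L ↓[ H ]) ∥ᴸ K ⊆ (L ∥ᴸ K) ↓[ H ]
  ∥ᴸ-↓ˡ {K} {L} K⊆SP (_ , _ , v , w , i) = go v w i
    where
    go : V ∈ L ↓[ H ] → W ∈ K → X ≅ V ∥ᴾ W → X ∈ (L ∥ᴸ K) ↓[ H ]
    go (incl v) w i = incl (_ , _ , v , w , i)
    go {W = W} (hyp h C s (Y , y , j)) w i =
      hyp h (parˡ C (K⊆SP w))
        (λ (_ , z , k) → go (s (_ , z , ≅-refl)) w (≅-trans k (parˡ-[] C (K⊆SP w))))
        (Y , y , ≅-trans i (≅-trans (∥ᴾ-cong j (≅-refl {V = W})) (≅-sym (parˡ-[] C (K⊆SP w)))))

  -- The factors are replaced one at a time, the left one first. The intermediate language is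
  -- `L′ ·ᴸ K`, hence the conditions on `L′` and `K`.
  ·ᴸ-mono-↓ : L′ ⊆ SP → K ⊆ SP →
              L ⊆ L′ ↓[ H ] → K ⊆ K′ ↓[ H ] → L ·ᴸ K ⊆ (L′ ·ᴸ K′) ↓[ H ]
  ·ᴸ-mono-↓ L′⊆SP K⊆SP L⊆L′↓ K⊆K′↓ x =
    ↓-least (λ y → ·ᴸ-↓ʳ L′⊆SP (·ᴸ-mono id K⊆K′↓ y)) (·ᴸ-↓ˡ K⊆SP (·ᴸ-mono L⊆L′↓ id x))

  ∥ᴸ-mono-↓ : L′ ⊆ SP → K ⊆ SP →
              L ⊆ L′ ↓[ H ] → K ⊆ K′ ↓[ H ] → L ∥ᴸ K ⊆ (L′ ∥ᴸ K′) ↓[ H ]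
  ∥ᴸ-mono-↓ L′⊆SP K⊆SP L⊆L′↓ K⊆K′↓ x =
    ↓-least
      -- The right factor is handled by swapping the two, replacing on the left, and swapping back
      -- under the closure.
      (λ y → ↓-mono ∥ᴸ-comm (∥ᴸ-↓ˡ L′⊆SP (∥ᴸ-comm (∥ᴸ-mono id K⊆K′↓ y))))
      (∥ᴸ-↓ˡ K⊆SP (∥ᴸ-mono L⊆L′↓ id x))

  ^ᴸ-mono-↓ : L ⊆ SP → K ⊆ SP → L ⊆ K ↓[ H ] → ∀ n → L ^ᴸ n ⊆ (K ^ᴸ n) ↓[ H ]
  ^ᴸ-mono-↓ L⊆SP K⊆SP L⊆K↓ zero    x = incl x
  ^ᴸ-mono-↓ L⊆SP K⊆SP L⊆K↓ (suc n) =
    ·ᴸ-mono-↓ K⊆SP (SP-^ᴸ L⊆SP n) L⊆K↓ (^ᴸ-mono-↓ L⊆SP K⊆SP L⊆K↓ n)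

  *ᴸ-mono-↓ : L ⊆ SP → K ⊆ SP → L ⊆ K ↓[ H ] → L *ᴸ ⊆ (K *ᴸ) ↓[ H ]
  *ᴸ-mono-↓ L⊆SP K⊆SP L⊆K↓ (n , x) = ↓-mono (n ,_) (^ᴸ-mono-↓ L⊆SP K⊆SP L⊆K↓ n x)

  -- The star is a union of powers, so it suffices to treat each power: a further factor `L` is
  -- multiplied onto `M ↓[ H ]`, pulled under the closure, and absorbed into `M`.
  *ᴸ-inductˡ : L ⊆ SP → K ⊆ M ↓[ H ] → L ·ᴸ M ⊆ M ↓[ H ] →
               K Respects _≅_ → L *ᴸ ·ᴸ K ⊆ M ↓[ H ]
  *ᴸ-inductˡ {L} {K} {M} L⊆SP K⊆M↓ LM⊆M↓ K-resp (V , W , (n , v) , w , i) =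
    go n (V , W , v , w , i)
    where
    go : ∀ n → L ^ᴸ n ·ᴸ K ⊆ M ↓[ H ]
    go zero    x = K⊆M↓ (proj₁ (·ᴸ-identityˡ K-resp) x)
    go (suc n) x = ↓-least LM⊆M↓ (·ᴸ-↓ʳ L⊆SP (·ᴸ-mono id (go n) (proj₁ ·ᴸ-assoc x)))

  -- Powers unfold on the left, next to `K`, so `K` is first exchanged for `M`. The induction then
  -- lets `M` absorb the leading factor of each power.
  *ᴸ-inductʳ : L ⊆ SP → K ⊆ M ↓[ H ] → M ·ᴸ L ⊆ M ↓[ H ] → M Respects _≅_ →
               K ·ᴸ L *ᴸ ⊆ M ↓[ H ]
  *ᴸ-inductʳ {L} {K} {M} L⊆SP K⊆M↓ ML⊆M↓ M-resp (V , W , v , (n , w) , i) =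
    ↓-least (go n) (·ᴸ-↓ˡ (SP-^ᴸ L⊆SP n) (V , W , K⊆M↓ v , w , i))
    where
    go : ∀ n → M ·ᴸ L ^ᴸ n ⊆ M ↓[ H ]
    go zero    x = incl (proj₁ (·ᴸ-identityʳ M-resp) x)
    go (suc n) x =
      ↓-least (go n) (·ᴸ-↓ˡ (SP-^ᴸ L⊆SP n) (·ᴸ-mono ML⊆M↓ id (proj₂ ·ᴸ-assoc x)))

module _ (Var Val : Set) (finVar : Finite Var) (finVal : Finite Val) where

  open POCKA Var Val finVar finVal

  private
    variable
      p q   : 𝒪
      α β γ : State
      P Q   : Pred State (lsuc 0ℓ)
      L K   : Language Act∪State

    _≟ᵛ_ = finite⇒≟ finVar
    _≟ⁿ_ = finite⇒≟ finVal

  -- Soundness of the observation algebra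

  ≤ˢ-refl : α ≤ˢ α
  ≤ˢ-refl = id , λ _ → refl

  ≤ˢ-trans : α ≤ˢ β → β ≤ˢ γ → α ≤ˢ γ
  ≤ˢ-trans (s , e) (s′ , e′) = s ∘ s′ , λ x → trans (e (s′ x)) (e′ x)

  ≤ˢ-value : ∀ {v n} → α ≤ˢ β → β v ≡ just n → α v ≡ just n
  ≤ˢ-value (_ , e) βv = trans (e (_ , βv)) βv

  ⟦⟧-down : ∀ p → α ≤ˢ β → β ∈ ⟦ p ⟧ᴼᴬ → α ∈ ⟦ p ⟧ᴼᴬ
  ⟦⟧-down top           _ _                      = _
  ⟦⟧-down (obs (v ≕ n)) α≤β (lift βv)            = lift (≤ˢ-value α≤β βv)
  ⟦⟧-down (p ∨ q)       α≤β (inj₁ x)             = inj₁ (⟦⟧-down p α≤β x)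
  ⟦⟧-down (p ∨ q)       α≤β (inj₂ x)             = inj₂ (⟦⟧-down q α≤β x)
  ⟦⟧-down (p ∧ q)       α≤β (x , y)              = ⟦⟧-down p α≤β x , ⟦⟧-down q α≤β y
  ⟦⟧-down (∁ p)         α≤β (Z , down , disj , z) = Z , down , disj , down α≤β z

  -- The witness is the principal downset of `α`. With `∁-elim` this is the Kripke reading of
  -- negation: no state extending `α` satisfies `p`, smaller states being the more defined ones.
  ∁-intro : ∀ p → (∀ {β} → β ≤ˢ α → ¬ β ∈ ⟦ p ⟧ᴼᴬ) → α ∈ ⟦ ∁ p ⟧ᴼᴬ
  ∁-intro {α} p disj = (_≤ˢ α) , ≤ˢ-trans , (λ _ (x , β≤α) → disj β≤α x) , ≤ˢ-refl

  ∁-elim : ∀ p → β ≤ˢ α → α ∈ ⟦ ∁ p ⟧ᴼᴬ → ¬ β ∈ ⟦ p ⟧ᴼᴬ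
  ∁-elim p β≤α (_ , down , disj , z) x = disj _ (x , down β≤α z)

  -- Overriding a state by finitely many assignments

  module _ {k} (v : Fin k → Var) (n : Fin k → Val) where

    extend : State → State
    extend α w with any? (λ i → v i ≟ᵛ w)
    ... | yes (i , _) = just (n i)
    ... | no _        = α w

    -- Consistency says that the override never changes a defined value, so it only enlarges the
    -- domain and moves down in the order.
    extend-≤ : (∀ i {m} → α (v i) ≡ just m → m ≡ n i) → extend α ≤ˢ α
    extend-≤ {α} consistent = (λ (_ , αw) → _ , trans (agree _ αw) αw) , λ (_ , αw) → agree _ αw
      where
      agree : ∀ w {m} → α w ≡ just m → extend α w ≡ α w
      agree w αw with any? (λ i → v i ≟ᵛ w)
      ... | yes (i , refl) = trans (cong just (sym (consistent i αw))) (sym αw)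
      ... | no _           = refl

    extend-value : Injective _≡_ _≡_ v → ∀ i → extend α (v i) ≡ just (n i)
    extend-value inj i with any? (λ j → v j ≟ᵛ v i)
    -- The search may return another index for the same variable; injectivity of `v` identifies the
    -- two.
    ... | yes (j , vj≡vi) = cong (just ∘ n) (inj vj≡vi)
    ... | no ∄j           = contradiction (i , refl) ∄j

  ⋁-intro : ∀ {ps} → p ∈ˡ ps → ⟦ p ⟧ᴼᴬ ⊆ ⟦ ⋁ ps ⟧ᴼᴬ
  ⋁-intro (here refl) x = inj₁ x
  ⋁-intro (there p∈)  x = inj₂ (⋁-intro p∈ x)

  ⋀-intro : ∀ {k} (f : Fin k → 𝒪) → (∀ i → α ∈ ⟦ f i ⟧ᴼᴬ) → α ∈ ⟦ ⋀ (tabulate f) ⟧ᴼᴬ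
  ⋀-intro {k = zero}  f x = _
  ⋀-intro {k = suc k} f x = x zero , ⋀-intro (f ∘ suc) (x ∘ suc)


  ∈-enumerate : ∀ n → n ∈ˡ enumerate finVal
  ∈-enumerate n =
    subst (_∈ˡ enumerate finVal) (strictlyInverseʳ n) (∈-map⁺ from (∈-allFin (to n)))
    where open Inverse (proj₂ finVal)

  other-value-sound : ∀ v n →
    ⟦ ∁ obs (v ≕ n) ⟧ᴼᴬ ⊆ ⟦ ⋁ (map (λ m → obs (v ≕ m)) (valuesOtherThan n)) ⟧ᴼᴬ
  other-value-sound v n {α} x with α v in αv
  ... | just m = ⋁-intro {p = obs (v ≕ m)}
    (∈-map⁺ _ (∈-filter⁺ (λ m → ¬? (m ≟ⁿ n)) (∈-enumerate m)
      (λ { refl → ∁-elim (obs (v ≕ n)) ≤ˢ-refl x (lift αv) })))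
    (lift αv)
  -- If `v` is undefined in `α`, then setting it to `n` gives a state below `α` that satisfies the
  -- negated observation.
  ... | nothing = contradiction (lift (extend-value v′ n′ {α} inj zero)) (∁-elim (obs (v ≕ n)) below x)
    where
    v′ : Fin 1 → Var
    v′ _ = v

    n′ : Fin 1 → Val
    n′ _ = n

    inj : Injective _≡_ _≡_ v′
    inj {zero} {zero} _ = refl

    below : extend v′ n′ α ≤ˢ α
    below = extend-≤ v′ n′ (λ _ αv≡m → contradiction (trans (sym αv) αv≡m) (λ ()))

  -- Either `α` already gives some `v i` a value other than `n i`, or all the assignments can be
  -- added to `α` at once. In the second case a state below `α` satisfies the negated meet. The
  -- search over `Fin k` makes this split constructive.
  ∁-⋀-sound : ∀ {k} (v : Fin k → Var) (n : Fin k → Val) → Injective _≡_ _≡_ v →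
    ⟦ ∁ ⋀ (tabulate λ i → obs (v i ≕ n i)) ⟧ᴼᴬ ⊆ ⟦ ⋁ (tabulate λ i → ∁ obs (v i ≕ n i)) ⟧ᴼᴬ
  ∁-⋀-sound {k} v n inj {α} x with any? conflict?
    where
    Conflict : Fin k → Set
    Conflict i = ∃[ m ] (α (v i) ≡ just m × m ≢ n i)

    conflict? : ∀ i → Dec (Conflict i)
    conflict? i with α (v i)
    ... | nothing = no λ { (_ , () , _) }
    ... | just m with m ≟ⁿ n i
    ...   | yes m≡n = no λ { (_ , refl , m≢n) → m≢n m≡n }
    ...   | no m≢n  = yes (m , refl , m≢n)
  -- Every state below `α` keeps the conflicting value `m`, so none of them satisfies the `i`-th
  -- observation.
  ... | yes (i , m , αv≡m , m≢n) =
    ⋁-intro (∈-tabulate⁺ i) (∁-intro (obs (v i ≕ n i)) λ β≤α (lift βv≡n) →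
      m≢n (just-injective (trans (sym (≤ˢ-value β≤α αv≡m)) βv≡n)))
  ... | no ∄conflict =
    contradiction
      (⋀-intro os (λ i → lift (extend-value v n {α} inj i)))
      (∁-elim (⋀ (tabulate os)) (extend-≤ v n consistent) x)
    where
    os : Fin k → 𝒪
    os i = obs (v i ≕ n i)

    consistent : ∀ i {m} → α (v i) ≡ just m → m ≡ n i
    consistent i {m} αv≡m with m ≟ⁿ n i
    ... | yes m≡n = m≡n
    ... | no m≢n  = contradiction (i , m , αv≡m , m≢n) ∄conflict

  ⊆⇒∪≐ : P ⊆ Q → P ∪ Q ≐ Q
  ⊆⇒∪≐ P⊆Q = either′ P⊆Q id , inj₂

  OA-sound : p ≡ᴼᴬ q → ⟦ p ⟧ᴼᴬ ≐ ⟦ q ⟧ᴼᴬ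
  OA-sound reflexivity           = ≐-refl
  OA-sound (symmetry e)          = ≐-sym (OA-sound e)
  OA-sound (transitivity e f)    = ≐-trans (OA-sound e) (OA-sound f)
  OA-sound (∨-cong e f)          with (s , s′) ← OA-sound e | (t , t′) ← OA-sound f =
    Sum.map s t , Sum.map s′ t′
  OA-sound (∧-cong e f)          with (s , s′) ← OA-sound e | (t , t′) ← OA-sound f =
    (λ (x , y) → s x , t y) , (λ (x , y) → s′ x , t′ y)
  OA-sound (∁-cong e)            with (s , s′) ← OA-sound e =
    (λ (Z , down , disj , z) → Z , down , (λ β (x , y) → disj β (s′ x , y)) , z) ,
    (λ (Z , down , disj , z) → Z , down , (λ β (x , y) → disj β (s x , y)) , z)
  OA-sound (∨-assoc p q r)       = assocʳ , assocˡ
  OA-sound (∧-assoc p q r)       =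
    (λ ((x , y) , z) → x , y , z) , (λ (x , y , z) → (x , y) , z)
  OA-sound (∨-comm p q)          = Sum.swap , Sum.swap
  OA-sound (∧-comm p q)          = swap , swap
  OA-sound (∨-absorbs-∧ p q)     = either′ id proj₁ , inj₁
  OA-sound (∧-absorbs-∨ p q)     = proj₁ , (λ x → x , inj₁ x)
  OA-sound (∨-distrib-∧ p q r)   =
    either′ (λ x → inj₁ x , inj₁ x) (λ (x , y) → inj₂ x , inj₂ y) ,
    (λ { (inj₁ x , _) → inj₁ x ; (inj₂ _ , inj₁ y) → inj₁ y ; (inj₂ x , inj₂ y) → inj₂ (x , y) })
  OA-sound (∧-distrib-∨ p q r)   =
    (λ (x , y) → Sum.map (x ,_) (x ,_) y) ,
    either′ (λ (x , y) → x , inj₁ y) (λ (x , y) → x , inj₂ y)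
  OA-sound (∨-identity p)        = either′ id (λ ()) , inj₁
  OA-sound (∧-identity p)        = proj₁ , (_, _)
  OA-sound (≦∁⇒disjoint {q = q} e) =
    (λ (x , y) → contradiction y (∁-elim q ≤ˢ-refl (proj₁ (OA-sound e) (inj₁ x)))) , λ ()
  -- Negation looks at all states below the given one, so membership in `p` is first carried down to
  -- `β`.
  OA-sound (disjoint⇒≦∁ {p} {q} e) = ⊆⇒∪≐ λ x →
    ∁-intro q λ β≤α y → lower (proj₁ (OA-sound e) (⟦⟧-down p β≤α x , y))
  OA-sound (single-valued v n≢m) =
    (λ (lift x , lift y) → contradiction (just-injective (trans (sym x) y)) n≢m) , λ ()
  OA-sound (other-value v n)     = ⊆⇒∪≐ (other-value-sound v n)
  OA-sound (∁-⋀ v n inj)         = ⊆⇒∪≐ (∁-⋀-sound v n inj)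

  -- Soundness of the axioms for terms

  states-mono : P ⊆ Q → states P ⊆ states Q
  states-mono P⊆Q (α , x , i) = α , P⊆Q x , i

  SP-states : states P ⊆ SP
  SP-states (α , _ , i) = iso (≅-sym i) (letter (inj₂ α))

  SP-State* : State* ⊆ SP
  SP-State* (n , x) = SP-^ᴸ SP-states n x

  SP-⦅⦆ : ∀ e → ⦅ e ⦆ ⊆ SP
  SP-⦅⦆ 𝟙        (lift i) = iso (≅-sym i) one
  SP-⦅⦆ (act a)           =
    SP-·ᴸ (SP-·ᴸ SP-State* (λ (lift i) → iso (≅-sym i) (letter (inj₁ a)))) SP-State*
  SP-⦅⦆ (test p)          = SP-·ᴸ (SP-·ᴸ SP-State* SP-states) SP-State*
  SP-⦅⦆ (e ⊹ f)           = either′ (SP-⦅⦆ e) (SP-⦅⦆ f)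
  SP-⦅⦆ (e · f)           = SP-·ᴸ (SP-⦅⦆ e) (SP-⦅⦆ f)
  SP-⦅⦆ (e ∥ f)           = SP-∥ᴸ (SP-⦅⦆ e) (SP-⦅⦆ f)
  SP-⦅⦆ (e ⋆)    (n , x)  = SP-^ᴸ (SP-⦅⦆ e) n x

  ⦅⦆-respects : ∀ e → ⦅ e ⦆ Respects _≅_
  ⦅⦆-respects 𝟙        i (lift j) = lift (≅-trans (≅-sym i) j)
  ⦅⦆-respects (act _)             = ·ᴸ-respects
  ⦅⦆-respects (test _)            = ·ᴸ-respects
  ⦅⦆-respects (e ⊹ f)  i          = Sum.map (⦅⦆-respects e i) (⦅⦆-respects f i)
  ⦅⦆-respects (_ · _)             = ·ᴸ-respects
  ⦅⦆-respects (_ ∥ _)             = ∥ᴸ-respects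
  ⦅⦆-respects (_ ⋆)               = *ᴸ-respects

  -- Languages up to closure

  infix 9 _↓
  infix 4 _≐↓_

  _↓ : Language Act∪State → Language Act∪State
  L ↓ = L ↓[ exch ∪ʰ contr ]

  -- Each inclusion starts from the language before closure, the form in which the congruence rules
  -- compose. By `↓-least` it amounts to equality of the closures.
  _≐↓_ : Rel (Language Act∪State) (lsuc 0ℓ)
  L ≐↓ K = L ⊆ K ↓ × K ⊆ L ↓

  ≐⇒≐↓ : L ≐ K → L ≐↓ K
  ≐⇒≐↓ (L⊆K , K⊆L) = (λ x → incl (L⊆K x)) , (λ x → incl (K⊆L x))

  ⊆↓⇒∪≐↓ : L ⊆ K ↓ → L ∪ K ≐↓ K
  ⊆↓⇒∪≐↓ L⊆K↓ = either′ L⊆K↓ incl , (λ x → incl (inj₂ x))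

  ⊆⇒∪≐↓ : L ⊆ K → L ∪ K ≐↓ K
  ⊆⇒∪≐↓ L⊆K = ⊆↓⇒∪≐↓ (λ x → incl (L⊆K x))

  ∪≐↓⇒⊆↓ : L ∪ K ≐↓ K → L ⊆ K ↓
  ∪≐↓⇒⊆↓ (L∪K⊆K↓ , _) x = L∪K⊆K↓ (inj₁ x)

  -- The four languages need not be denoted by terms of the hypotheses, so the exchange hypothesis
  -- is instantiated afresh for each pomset, at the terms naming its four components.
  exchange-⊆ : ∀ {A B C D} → A ⊆ SP → B ⊆ SP → C ⊆ SP → D ⊆ SP →
               (A ∥ᴸ B) ·ᴸ (C ∥ᴸ D) ⊆ ((A ·ᴸ C) ∥ᴸ (B ·ᴸ D)) ↓
  exchange-⊆ {A} {B} {C} {D} A⊆SP B⊆SP C⊆SP D⊆SP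
    (V , W , (V₁ , V₂ , a , b , i) , (W₁ , W₂ , c , d , j) , k) =
    hyp (inj₁ (exch-≤ (toTerm a′) (toTerm b′) (toTerm c′) (toTerm d′))) □
      -- Up to isomorphism the larger side denotes only `(V₁ ·ᴾ W₁) ∥ᴾ (V₂ ·ᴾ W₂)`, which already
      -- lies in the target before closure.
      (λ (_ , (_ , _ , (_ , _ , x , z , l) , (_ , _ , y , w , m) , n) , o) →
        incl (V₁ ·ᴾ W₁ , V₂ ·ᴾ W₂ ,
              (V₁ , W₁ , a , c , ≅-refl) , (V₂ , W₂ , b , d , ≅-refl) ,
              ≅-trans o (≅-trans (□-[] _) (≅-trans n (∥ᴾ-cong
                (≅-trans l (·ᴾ-cong (only a′ x) (only c′ z)))
                (≅-trans m (·ᴾ-cong (only b′ y) (only d′ w))))))))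
      (V ·ᴾ W ,
        (V , W , (V₁ , V₂ , self a′ , self b′ , i) , (W₁ , W₂ , self c′ , self d′ , j) , ≅-refl) ,
        ≅-trans k (≅-sym (□-[] _)))
    where
    a′ = A⊆SP a
    b′ = B⊆SP b
    c′ = C⊆SP c
    d′ = D⊆SP d

    only : ∀ {X Y} (x : SP X) → Y ∈ ⟦ toTerm x ⟧ᴮᴷᴬ → Y ≅ X
    only x y = lower (proj₁ (⟦toTerm⟧ x) y)

    self : ∀ {X} (x : SP X) → X ∈ ⟦ toTerm x ⟧ᴮᴷᴬ
    self x = proj₂ (⟦toTerm⟧ x) (lift ≅-refl)

  -- The larger side of the contraction for `α` denotes only `α` followed by itself; the first copy
  -- is counted in `P` and the second in `Q`.
  contract : states (P ∩ Q) ⊆ (states P ·ᴸ states Q) ↓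
  contract (α , (x , y) , i) =
    hyp (inj₂ (contr-≤ α)) □
      (λ (_ , (V , W , lift j , lift k , l) , m) →
        incl (V , W , (α , x , j) , (α , y , k) , ≅-trans m (≅-trans (□-[] _) l)))
      (⟨ inj₂ α ⟩ , lift ≅-refl , ≅-trans i (≅-sym (□-[] _)))

  -- The shape shared by the semantics of actions and tests, so that the interface axioms for both
  -- have common proofs.
  ⟪_⟫ : Language Act∪State → Language Act∪State
  ⟪ L ⟫ = State* ·ᴸ L ·ᴸ State*

  ⟪⟫-mono : L ⊆ K → ⟪ L ⟫ ⊆ ⟪ K ⟫
  ⟪⟫-mono L⊆K = ·ᴸ-mono (·ᴸ-mono id L⊆K) id

  -- The middle state is a word of length one, and three words of states concatenate to one.
  ⟪states⟫⊆State* : ⟪ states P ⟫ ⊆ State*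
  ⟪states⟫⊆State* x =
    *ᴸ-·ᴸ-*ᴸ (·ᴸ-mono (λ y → *ᴸ-·ᴸ-*ᴸ (·ᴸ-mono id (λ z → ⊆*ᴸ (states-mono _ z)) y)) id x)

  State*·⟪⟫ : State* ·ᴸ ⟪ L ⟫ ⊆ ⟪ L ⟫
  State*·⟪⟫ x =
    ·ᴸ-mono (λ y → ·ᴸ-mono *ᴸ-·ᴸ-*ᴸ id (proj₂ ·ᴸ-assoc y)) id (proj₂ ·ᴸ-assoc x)

  ⟪⟫·State* : ⟪ L ⟫ ·ᴸ State* ⊆ ⟪ L ⟫
  ⟪⟫·State* x = ·ᴸ-mono id *ᴸ-·ᴸ-*ᴸ (proj₁ ·ᴸ-assoc x)

  -- The paddings that must appear between `L` and `K` are chosen empty.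
  ⟪⟫-· : ⟪ L ·ᴸ K ⟫ ⊆ ⟪ L ⟫ ·ᴸ ⟪ K ⟫
  ⟪⟫-· x = ·ᴸ-mono pad pad′ (proj₁ ·ᴸ-assoc (·ᴸ-mono (proj₂ ·ᴸ-assoc) id x))
    where
    pad : State* ·ᴸ L ⊆ ⟪ L ⟫
    pad y = ·ᴸ-mono id (λ (lift i) → *ᴸ-respects (≅-sym i) 1∈*ᴸ) (proj₂ (·ᴸ-identityʳ ·ᴸ-respects) y)

    pad′ : L ·ᴸ State* ⊆ ⟪ L ⟫
    pad′ y = proj₂ ·ᴸ-assoc
      (·ᴸ-mono (λ (lift i) → *ᴸ-respects (≅-sym i) 1∈*ᴸ) id (proj₂ (·ᴸ-identityˡ ·ᴸ-respects) y))

  ⟪⟫-mono-↓ : L ⊆ SP → L ⊆ K ↓ → ⟪ L ⟫ ⊆ ⟪ K ⟫ ↓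
  ⟪⟫-mono-↓ L⊆SP L⊆K↓ x =
    ↓-least (·ᴸ-↓ˡ SP-State*)
      (incl (·ᴸ-mono (λ y → ·ᴸ-↓ʳ SP-State* (·ᴸ-mono id L⊆K↓ y)) id x))

  -- The prefix consists of states only and merges into the left padding of `L`.
  top-·-⊆ : ⟪ states P ⟫ ·ᴸ ⟪ L ⟫ ⊆ ⟪ L ⟫
  top-·-⊆ x = State*·⟪⟫ (·ᴸ-mono ⟪states⟫⊆State* id x)

  ·-top-⊆ : ⟪ L ⟫ ·ᴸ ⟪ states P ⟫ ⊆ ⟪ L ⟫
  ·-top-⊆ x = ⟪⟫·State* (·ᴸ-mono id ⟪states⟫⊆State* x)

  ⟪⟫-∪ : ⟪ states (P ∪ Q) ⟫ ≐ ⟪ states P ⟫ ∪ ⟪ states Q ⟫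
  ⟪⟫-∪ =
    (λ { (_ , Z , (X , _ , x , (α , inj₁ y , i) , j) , z , k) →
           inj₁ (_ , Z , (X , _ , x , (α , y , i) , j) , z , k)
       ; (_ , Z , (X , _ , x , (α , inj₂ y , i) , j) , z , k) →
           inj₂ (_ , Z , (X , _ , x , (α , y , i) , j) , z , k) }) ,
    either′ (⟪⟫-mono (states-mono inj₁)) (⟪⟫-mono (states-mono inj₂))

  sound : ∀ {e f} → e ≡ᵀ f → ⦅ e ⦆ ≐↓ ⦅ f ⦆
  sound reflexivity  = ≐⇒≐↓ ≐-refl
  sound (symmetry r) = swap (sound r)
  sound (transitivity r s) with (r₁ , r₂) ← sound r | (s₁ , s₂) ← sound s =
    (λ x → ↓-least s₁ (r₁ x)) , (λ x → ↓-least r₂ (s₂ x))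
  sound (⊹-cong r s) with (r₁ , r₂) ← sound r | (s₁ , s₂) ← sound s =
    either′ (λ x → ↓-mono inj₁ (r₁ x)) (λ x → ↓-mono inj₂ (s₁ x)) ,
    either′ (λ x → ↓-mono inj₁ (r₂ x)) (λ x → ↓-mono inj₂ (s₂ x))
  sound (·-cong {e} {e′} {f} {f′} r s) with (r₁ , r₂) ← sound r | (s₁ , s₂) ← sound s =
    ·ᴸ-mono-↓ (SP-⦅⦆ e′) (SP-⦅⦆ f) r₁ s₁ , ·ᴸ-mono-↓ (SP-⦅⦆ e) (SP-⦅⦆ f′) r₂ s₂
  sound (∥-cong {e} {e′} {f} {f′} r s) with (r₁ , r₂) ← sound r | (s₁ , s₂) ← sound s =
    ∥ᴸ-mono-↓ (SP-⦅⦆ e′) (SP-⦅⦆ f) r₁ s₁ , ∥ᴸ-mono-↓ (SP-⦅⦆ e) (SP-⦅⦆ f′) r₂ s₂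
  sound (⋆-cong {e} {e′} r) with (r₁ , r₂) ← sound r =
    *ᴸ-mono-↓ (SP-⦅⦆ e) (SP-⦅⦆ e′) r₁ , *ᴸ-mono-↓ (SP-⦅⦆ e′) (SP-⦅⦆ e) r₂
  sound (OA r) with (s , s′) ← OA-sound r =
    ≐⇒≐↓ (⟪⟫-mono (states-mono s) , ⟪⟫-mono (states-mono s′))
  sound (⊹-assoc e f g) = ≐⇒≐↓ (assocʳ , assocˡ)
  sound (⊹-comm e f)    = ≐⇒≐↓ (Sum.swap , Sum.swap)
  sound (⊹-idem e)      = ≐⇒≐↓ (either′ id id , inj₁)
  sound (⊹-identity e)  = ≐⇒≐↓ (either′ id (λ ()) , inj₁)
  sound (·-assoc e f g) = ≐⇒≐↓ ·ᴸ-assoc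
  sound (·-identityˡ e) = ≐⇒≐↓ (·ᴸ-identityˡ (⦅⦆-respects e))
  sound (·-identityʳ e) = ≐⇒≐↓ (·ᴸ-identityʳ (⦅⦆-respects e))
  sound (·-zeroˡ e)     = ≐⇒≐↓ ((λ { (_ , _ , () , _) }) , λ ())
  sound (·-zeroʳ e)     = ≐⇒≐↓ ((λ { (_ , _ , _ , () , _) }) , λ ())
  sound (·-distribˡ-⊹ e f g) = ≐⇒≐↓ ·ᴸ-distribˡ-∪
  sound (·-distribʳ-⊹ e f g) = ≐⇒≐↓ ·ᴸ-distribʳ-∪
  sound (⋆-unfoldˡ e)        = ≐⇒≐↓ *ᴸ-unfoldˡ
  sound (⋆-unfoldʳ e)        = ≐⇒≐↓ (*ᴸ-unfoldʳ (⦅⦆-respects e))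
  -- The premise bounds a union; its two injections are the base case and the absorption step of the
  -- induction.
  sound (⋆-inductʳ {e} {f} {g} r) with s ← ∪≐↓⇒⊆↓ (sound r) =
    ⊆↓⇒∪≐↓ (*ᴸ-inductʳ (SP-⦅⦆ g) (λ x → s (inj₁ x)) (λ x → s (inj₂ x)) (⦅⦆-respects f))
  sound (⋆-inductˡ {e} {f} {g} r) with s ← ∪≐↓⇒⊆↓ (sound r) =
    ⊆↓⇒∪≐↓ (*ᴸ-inductˡ (SP-⦅⦆ f) (λ x → s (inj₁ x)) (λ x → s (inj₂ x)) (⦅⦆-respects e))
  sound (∥-assoc e f g)     = ≐⇒≐↓ ∥ᴸ-assoc
  sound (∥-comm e f)        = ≐⇒≐↓ (∥ᴸ-comm , ∥ᴸ-comm)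
  sound (∥-identity e)      = ≐⇒≐↓ (∥ᴸ-identityʳ (⦅⦆-respects e))
  sound (∥-zero e)          = ≐⇒≐↓ ((λ { (_ , _ , _ , () , _) }) , λ ())
  sound (∥-distrib-⊹ e f g) = ≐⇒≐↓ ∥ᴸ-distribˡ-∪
  sound (exchange e f g h)  =
    ⊆↓⇒∪≐↓ (exchange-⊆ (SP-⦅⦆ e) (SP-⦅⦆ f) (SP-⦅⦆ g) (SP-⦅⦆ h))
  -- The state in the middle is doubled by contraction inside its padding, and empty padding is then
  -- inserted between the copies.
  sound (∧≦· p q)    = ⊆↓⇒∪≐↓ (λ x → ↓-mono ⟪⟫-· (⟪⟫-mono-↓ SP-states contract x))
  sound (∨≡⊹ p q)    = ≐⇒≐↓ ⟪⟫-∪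
  sound 𝟘≡bot        = ≐⇒≐↓ ((λ ()) , λ { (_ , _ , (_ , _ , _ , (_ , () , _) , _) , _) })
  sound (top·test p) = ⊆⇒∪≐↓ top-·-⊆
  sound (test·top p) = ⊆⇒∪≐↓ ·-top-⊆
  sound (top·act a)  = ⊆⇒∪≐↓ top-·-⊆
  sound (act·top a)  = ⊆⇒∪≐↓ ·-top-⊆

theorem3p14 : (Var Val : Set) (finVar : Finite Var) (finVal : Finite Val) →
              let open POCKA Var Val finVar finVal in
              (e f : 𝒯) → e ≡ᵀ f → ⦅ e ⦆↓ ≐ ⦅ f ⦆↓
theorem3p14 Var Val finVar finVal e f e≡f
  with s , s′ ← sound Var Val finVar finVal e≡f = ↓-least s , ↓-least s′
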